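{- For all $n\ge 1$, $$I_n(-1,t)=\sum_{\sigma\in\mathrm{Av}_n(321)}(-1)^{\mathrm{inv}\,\sigma}t^{\mathrm{lrm}\,\sigma}=\sum_{k=1}^{n}(-1)^{n-k}s_{n,k}\,t^k,$$ where $s_{n,k}$ is defined for $n\ge k\ge 1$ by $$s_{n,k}=\binom{\left\lfloor\frac{n-1}{2}\right\rfloor}{\left\lfloor\frac{k-1}{2}\right\rfloor}\binom{\left\lceil\frac{n-1}{2}\right\rceil}{\left\lceil\frac{k-1}{2}\right\rceil}.$$ Moreover, for all $n\ge 1$, $$I_{2n}(-1,t)=(t-1)\,I_{2n-1}(-1,t),$$ $$(n+1)\,I_{2n+1}(-1,t)=2\big((1+t^2)n-t\big)I_{2n-1}(-1,t)-(1-t^2)^2(n-1)\,I_{2n-3}(-1,t),$$ where for $n=1$ the last term, whose coefficient contains the factor $n-1=0$, is read as $0$.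
   Context: Let $\mathfrak S_n$ be the symmetric group of permutations $\sigma=b_1\ldots b_n$ (in one-line notation) of $[n]=\{1,\ldots,n\}$. Let $\mathrm{Av}_n(321)$ be the set of $\sigma=b_1\ldots b_n\in\mathfrak S_n$ avoiding the pattern $321$, i.e. such that there are no indices $i<j<l$ with $b_i>b_j>b_l$. For $\sigma=b_1\ldots b_n$ define the inversion number $\mathrm{inv}\,\sigma=\#\{(i,j)\mid i<j \text{ and } b_i>b_j\}$ and the number of left-right maxima $\mathrm{lrm}\,\sigma=\#\{i\mid b_i>b_j\text{ for all } j<i\}$ (so $i=1$ is always counted when $n\ge1$). The inversion number polynomial is $I_n(q,t)=\sum_{\sigma\in\mathrm{Av}_n(321)}q^{\mathrm{inv}\,\sigma}t^{\mathrm{lrm}\,\sigma}$, and $I_n(-1,t)$ is its specialization at $q=-1$, a polynomial in $t$. -}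

module Defs where

open import Algebra.Bundles.Raw using (RawRing)
import Algebra.Definitions.RawSemiring as RawSemiringDefs
open import Data.Fin.Base as Fin using (Fin)
import Data.Fin.Properties as Fin
open import Data.Integer.Base as ℤ using (ℤ; -1ℤ)
open import Data.List.Base as List using (List; []; _∷_)
open import Data.Nat.Base as ℕ using (ℕ; zero; suc; ⌊_/2⌋; ⌈_/2⌉)
open import Data.Nat.Combinatorics using (_C_)
open import Data.Product.Base using (∃; _×_; _,_)
open import Data.Vec.Base as Vec using (Vec; lookup)
open import Data.Vec.Relation.Unary.AllPairs using (allPairs?)
open import Data.Vec.Relation.Unary.Unique.Propositional using (Unique)
open import Relation.Binary.Core using (Rel)
open import Relation.Nullary.Decidable using (Dec; ¬?; _×-dec_; _→-dec_)
open import Relation.Nullary.Negation using (¬_)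

module RingNotation {c ℓ} (R : RawRing c ℓ) where

  open RawRing R public
  -- n · x is the n-fold sum x + ⋯ + x.
  open RawSemiringDefs rawSemiring public using (_^_) renaming (_×_ to _·_)

  infixl 6 _-_
  _-_ : Carrier → Carrier → Carrier
  x - y = x + (- y)

  ∑ : ∀ {a} {A : Set a} → List A → (A → Carrier) → Carrier
  ∑ xs f = List.foldr _+_ 0# (List.map f xs)

  infixr 5 ∑
  syntax ∑ xs (λ x → e) = ∑[ x ∈ xs ] e

-- A polynomial is its list of coefficients, constant term first.  Trailing
-- zeros are allowed, so equality of polynomials is equality of coefficients.
module Polynomial {c ℓ} (R : RawRing c ℓ) where

  private module R = RawRing R

  Poly : Set c
  Poly = List R.Carrier

  coeff : Poly → ℕ → R.Carrier
  coeff []      _       = R.0#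
  coeff (a ∷ _) zero    = a
  coeff (_ ∷ p) (suc i) = coeff p i

  -- A record, rather than a plain function type, so that p and q can be
  -- inferred from p ≈ q.
  infix 4 _≈_
  record _≈_ (p q : Poly) : Set ℓ where
    constructor mk≈
    field coeff-≈ : ∀ i → coeff p i R.≈ coeff q i

  infixl 6 _+_
  _+_ : Poly → Poly → Poly
  []      + q       = q
  (a ∷ p) + []      = a ∷ p
  (a ∷ p) + (b ∷ q) = (a R.+ b) ∷ (p + q)

  -- (a + X p) q = a q + X (p q)
  infixl 7 _*_
  _*_ : Poly → Poly → Poly
  []      * q = []
  (a ∷ p) * q = List.map (a R.*_) q + (R.0# ∷ (p * q))

  const : R.Carrier → Poly
  const a = a ∷ []

  X : Poly
  X = R.0# ∷ R.1# ∷ []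

  evaluate : R.Carrier → Poly → R.Carrier
  evaluate x []      = R.0#
  evaluate x (a ∷ p) = a R.+ x R.* evaluate x p

  rawRing : RawRing c ℓ
  rawRing = record
    { Carrier = Poly
    ; _≈_     = _≈_
    ; _+_     = _+_
    ; _*_     = _*_
    ; -_      = List.map R.-_
    ; 0#      = []
    ; 1#      = const R.1#
    }

module ℤ[t]-Poly    = Polynomial ℤ.+-*-rawRing
module ℤ[q]-Poly    = Polynomial ℤ.+-*-rawRing
module ℤ[q][t]-Poly = Polynomial ℤ[q]-Poly.rawRing

module ℤ[q]    = RingNotation ℤ[q]-Poly.rawRing
module ℤ[q][t] = RingNotation ℤ[q][t]-Poly.rawRing

open RingNotation ℤ[t]-Poly.rawRing public
  using (_≈_; _+_; _*_; -_; _-_; 0#; 1#; _^_; _·_; ∑)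
  renaming (Carrier to ℤ[t])

t : ℤ[t]
t = ℤ[t]-Poly.X

specialise : ℤ → ℤ[q][t].Carrier → ℤ[t]
specialise q₀ = List.map (ℤ[q]-Poly.evaluate q₀)

-- One-line notation; the letters are 0, …, n-1 instead of 1, …, n, and only
-- their relative order matters below.
Word : ℕ → Set
Word n = Vec (Fin n) n

vecs : ∀ {a} {A : Set a} → List A → (m : ℕ) → List (Vec A m)
vecs as zero    = Vec.[] ∷ []
vecs as (suc m) = List.cartesianProductWith Vec._∷_ as (vecs as m)

unique? : ∀ {n} (σ : Word n) → Dec (Unique σ)
unique? = allPairs? (λ a b → ¬? (a Fin.≟ b))

-- A word of length n on n letters is a permutation iff its letters are distinct.
𝔖 : (n : ℕ) → List (Word n)
𝔖 n = List.filter unique? (vecs (List.allFin n) n)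

module _ {n : ℕ} (σ : Word n) where

  private
    b : Fin n → Fin n
    b = lookup σ

  Contains321 : Set
  Contains321 = ∃ λ i → ∃ λ j → ∃ λ l →
    (i Fin.< j × j Fin.< l) × (b i Fin.> b j × b j Fin.> b l)

  contains321? : Dec Contains321
  contains321? = Fin.any? λ i → Fin.any? λ j → Fin.any? λ l →
    (i Fin.<? j ×-dec j Fin.<? l) ×-dec (b j Fin.<? b i ×-dec b l Fin.<? b j)

  Avoids321 : Set
  Avoids321 = ¬ Contains321

  avoids321? : Dec Avoids321
  avoids321? = ¬? contains321?

  Inversion : Fin n × Fin n → Set
  Inversion (i , j) = i Fin.< j × b i Fin.> b j

  inversion? : ∀ ij → Dec (Inversion ij)
  inversion? (i , j) = i Fin.<? j ×-dec b j Fin.<? b i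

  LRMax : Fin n → Set
  LRMax i = ∀ j → j Fin.< i → b i Fin.> b j

  lrMax? : ∀ i → Dec (LRMax i)
  lrMax? i = Fin.all? λ j → j Fin.<? i →-dec b j Fin.<? b i

  inv : ℕ
  inv = List.length
    (List.filter inversion? (List.cartesianProduct (List.allFin n) (List.allFin n)))

  lrm : ℕ
  lrm = List.length (List.filter lrMax? (List.allFin n))

Av321 : (n : ℕ) → List (Word n)
Av321 n = List.filter avoids321? (𝔖 n)

I : ℕ → ℤ[q][t].Carrier
I n = ℤ[q][t].∑ (Av321 n) λ σ →
  ℤ[q][t]-Poly.const (q ℤ[q].^ inv σ) ℤ[q][t].* T ℤ[q][t].^ lrm σ
  where
  q = ℤ[q]-Poly.X
  T = ℤ[q][t]-Poly.X

-- I_n(-1, t)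
I₋₁ : ℕ → ℤ[t]
I₋₁ n = specialise -1ℤ (I n)

-- Meant for n ≥ k ≥ 1, where the truncated subtractions are exact.
s : ℕ → ℕ → ℕ
s n k = (⌊ n ℕ.∸ 1 /2⌋ C ⌊ k ℕ.∸ 1 /2⌋) ℕ.* (⌈ n ℕ.∸ 1 /2⌉ C ⌈ k ℕ.∸ 1 /2⌉)

[1⋯_] : ℕ → List ℕ
[1⋯ n ] = List.applyUpTo suc n

{-# OPTIONS --safe #-}

-- Read a 321-avoiding permutation from left to right.  Each letter is either a
-- left-right maximum or the smallest letter not used before, so the possible
-- continuations depend only on the number n of unused letters and the number h of those
-- below the current maximum.  The sums F n h over all continuations satisfy
--   F (n + 1) h = F n (h - 1) + t ∑_{h ≤ a ≤ n} qᵃ F n a,    F n 0 = Iₙ(q, t).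
-- At q = -1 this recursion is solved, according to the parities of n and n - h, by
-- combinations of the polynomials Gₛ(a, b) = ∑ⱼ C(a, j) C(b, j + s) t²ʲ, s ∈ {-1, 0, 1},
-- using only Pascal's rule.  With Aₘ = G₀(m, m) and Bₘ = G₁(m, m), the case h = 0 reads
--   I₂ₘ₊₁(-1, t) = t (Aₘ - t Bₘ),    I₂ₘ₊₂(-1, t) = (t - 1) I₂ₘ₊₁(-1, t).
-- The three-term recurrence follows from
--   Aₘ₊₁ = (1 + t²) Aₘ + 2 t² Bₘ,    (m + 2) Bₘ₊₁ = (m + 1) (2 Aₘ + (1 + t²) Bₘ).

module Submission where

open import Algebra.Bundles using (CommutativeRing; CommutativeSemigroup)
open import Algebra.Bundles.Raw using (RawRing)
open import Algebra.Structures using (IsSemigroup)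
import Algebra.Properties.AbelianGroup as AbelianGroupProperties
import Algebra.Properties.CommutativeSemigroup as CommutativeSemigroupProperties
import Algebra.Properties.Ring as RingProperties
import Algebra.Properties.Semiring.Exp as Exp
import Algebra.Properties.Semiring.Mult as Mult
import Algebra.Solver.Ring as RingSolver
open import Algebra.Solver.Ring.AlmostCommutativeRing using (_-Raw-AlmostCommutative⟶_; fromCommutativeRing)
open import Data.Bool.Base using (true; false; if_then_else_)
open import Data.Fin.Base as Fin using (Fin; punchIn; toℕ)
import Data.Fin.Properties as Fin
open import Data.Integer.Base as ℤ using (ℤ; -1ℤ)
import Data.Integer.Properties as ℤ
open import Data.Integer.Solver using (module +-*-Solver)
open import Data.List.Base as List using (List; []; _∷_; _++_; allFin)
import Data.List.Properties as List
import Data.List.Relation.Unary.All as ListAll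
import Data.List.Relation.Unary.All.Properties as ListAll
import Data.Maybe.Base as Maybe
open import Data.Nat.Base as ℕ
  using (ℕ; zero; suc; _∸_; _<_; _≤_; _≥_; z≤n; s≤s; z<s; s<s; s<s⁻¹; s≤s⁻¹; ⌊_/2⌋; ⌈_/2⌉)
open import Data.Nat.Combinatorics using (_C_; nCk+nC[k+1]≡[n+1]C[k+1]; nC1≡n; k>n⇒nCk≡0)
import Data.Nat.Properties as ℕ
open import Data.Product.Base using (∃; _×_; _,_; proj₂; uncurry)
open import Data.Sum.Base using (inj₁; inj₂)
open import Data.Unit.Base using (⊤; tt)
open import Data.Vec.Base as Vec using (Vec; []; _∷_; lookup)
open import Data.Vec.Relation.Unary.All as All using (All; []; _∷_)
import Data.Vec.Relation.Unary.All.Properties as All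
open import Data.Vec.Relation.Unary.AllPairs as AllPairs using ([]; _∷_; allPairs?)
import Data.Vec.Relation.Unary.AllPairs.Properties as AllPairs
open import Data.Vec.Relation.Unary.Unique.Propositional using (Unique)
open import Defs
  using ( module RingNotation; module Polynomial; Word; vecs; unique?; 𝔖; Av321; Avoids321; avoids321?
        ; Inversion; inversion?; inv; LRMax; lrMax?; lrm; s; [1⋯_])
open import Function.Base using (_∘_; id)
open import Function.Bundles using (_⇔_; mk⇔; module Equivalence)
open import Level using (Level)
open import Relation.Binary.Bundles using (Setoid)
open import Relation.Binary.PropositionalEquality as ≡ using (_≡_; _≢_)
import Relation.Binary.Reasoning.Setoid as ≈-Reasoning
open import Relation.Nullary.Decidable
  using (Dec; yes; no; does; ¬?; _×-dec_; _→-dec_; does-⇔; dec-true; dec-false; dec⇒maybe)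
open import Relation.Nullary.Negation using (¬_; contradiction)
open import Relation.Unary using (Pred; Decidable; _≐_)

-- The obstacle is the boundary `h = 0`, where the first summand of the recursion is missing. It can
-- therefore be run for all `e`, from an initial row whose entries beyond `e = 0` are free;
-- requiring a zero at `e = n + 1` for every `n` determines them one by one as 0, -t, 0, -t, ....
-- From this row the parity pattern propagates. The polynomials Gₛ(a, b) arise as follows: with x =
-- t², Gₛ(a, b) is the coefficient of yˢ in (1 + x/y)ᵃ (1 + y)ᵇ. Two steps in `n` contribute a
-- factor 1 + x/y, two steps in `e` a factor 1 + y, and the zeros at `e = n + 1` come from the
-- symmetry y ↦ x/y, which exchanges the two factors.

-- Coefficient lists over a commutative ring form a commutative ring.

module PolynomialRing {c ℓ} (R : CommutativeRing c ℓ) where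

  private module R = CommutativeRing R

  open Polynomial R.rawRing

  private
    infixl 7 _∙_
    _∙_ : R.Carrier → Poly → Poly
    a ∙ p = List.map (a R.*_) p

    -‿ : Poly → Poly
    -‿ p = List.map (λ a → R.- a) p

  ≈-setoid : Setoid c ℓ
  ≈-setoid = record
    { Carrier = Poly
    ; _≈_ = _≈_
    ; isEquivalence = record
      { refl  = mk≈ λ _ → R.refl
      ; sym   = λ (mk≈ p≈q) → mk≈ λ i → R.sym (p≈q i)
      ; trans = λ (mk≈ p≈q) (mk≈ q≈r) → mk≈ λ i → R.trans (p≈q i) (q≈r i)
      }
    }

  open Setoid ≈-setoid using (refl; sym; trans; isEquivalence)
  open ≈-Reasoning ≈-setoid

  coeff-+ : ∀ p q i → coeff (p + q) i R.≈ coeff p i R.+ coeff q i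
  coeff-+ []      q       i       = R.sym (R.+-identityˡ _)
  coeff-+ (a ∷ p) []      i       = R.sym (R.+-identityʳ _)
  coeff-+ (a ∷ p) (b ∷ q) zero    = R.refl
  coeff-+ (a ∷ p) (b ∷ q) (suc i) = coeff-+ p q i

  coeff-∙ : ∀ a p i → coeff (a ∙ p) i R.≈ a R.* coeff p i
  coeff-∙ a []      i       = R.sym (R.zeroʳ a)
  coeff-∙ a (b ∷ p) zero    = R.refl
  coeff-∙ a (b ∷ p) (suc i) = coeff-∙ a p i

  coeff-neg : ∀ p i → coeff (-‿ p) i R.≈ R.- coeff p i
  coeff-neg []      i       = R.sym ε⁻¹≈ε
    where open AbelianGroupProperties R.+-abelianGroup using (ε⁻¹≈ε)
  coeff-neg (b ∷ p) zero    = R.refl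
  coeff-neg (b ∷ p) (suc i) = coeff-neg p i

  ∷-cong : ∀ {a b p q} → a R.≈ b → p ≈ q → a ∷ p ≈ b ∷ q
  ∷-cong a≈b (mk≈ p≈q) = mk≈ λ { zero → a≈b ; (suc i) → p≈q i }

  0∷0≈0 : R.0# ∷ [] ≈ []
  0∷0≈0 = mk≈ λ { zero → R.refl ; (suc i) → R.refl }

  +-cong : ∀ {p p′ q q′} → p ≈ p′ → q ≈ q′ → p + q ≈ p′ + q′
  +-cong {p} {p′} {q} {q′} (mk≈ p≈p′) (mk≈ q≈q′) = mk≈ λ i →
    R.trans (coeff-+ p q i) (R.trans (R.+-cong (p≈p′ i) (q≈q′ i)) (R.sym (coeff-+ p′ q′ i)))

  +-assoc : ∀ p q r → (p + q) + r ≈ p + (q + r)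
  +-assoc []      q       r       = refl
  +-assoc (a ∷ p) []      r       = refl
  +-assoc (a ∷ p) (b ∷ q) []      = refl
  +-assoc (a ∷ p) (b ∷ q) (c ∷ r) = ∷-cong (R.+-assoc a b c) (+-assoc p q r)

  +-comm : ∀ p q → p + q ≈ q + p
  +-comm []      []      = refl
  +-comm []      (b ∷ q) = refl
  +-comm (a ∷ p) []      = refl
  +-comm (a ∷ p) (b ∷ q) = ∷-cong (R.+-comm a b) (+-comm p q)

  +-identityʳ : ∀ p → p + [] ≈ p
  +-identityʳ []      = refl
  +-identityʳ (a ∷ p) = refl

  -‿cong : ∀ {p q} → p ≈ q → -‿ p ≈ -‿ q
  -‿cong {p} {q} (mk≈ p≈q) = mk≈ λ i →
    R.trans (coeff-neg p i) (R.trans (R.-‿cong (p≈q i)) (R.sym (coeff-neg q i)))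

  -‿inverseˡ : ∀ p → -‿ p + p ≈ []
  -‿inverseˡ []      = refl
  -‿inverseˡ (a ∷ p) = trans (∷-cong (R.-‿inverseˡ a) (-‿inverseˡ p)) 0∷0≈0

  ∙-cong : ∀ {a b p q} → a R.≈ b → p ≈ q → a ∙ p ≈ b ∙ q
  ∙-cong {a} {b} {p} {q} a≈b (mk≈ p≈q) = mk≈ λ i →
    R.trans (coeff-∙ a p i) (R.trans (R.*-cong a≈b (p≈q i)) (R.sym (coeff-∙ b q i)))

  ∙-zeroˡ : ∀ p → R.0# ∙ p ≈ []
  ∙-zeroˡ p = mk≈ λ i → R.trans (coeff-∙ R.0# p i) (R.zeroˡ _)

  ∙-identityˡ : ∀ p → R.1# ∙ p ≈ p
  ∙-identityˡ p = mk≈ λ i → R.trans (coeff-∙ R.1# p i) (R.*-identityˡ _)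

  ∙-distribˡ : ∀ a p q → a ∙ (p + q) ≈ a ∙ p + a ∙ q
  ∙-distribˡ a []      q       = refl
  ∙-distribˡ a (b ∷ p) []      = refl
  ∙-distribˡ a (b ∷ p) (c ∷ q) = ∷-cong (R.distribˡ a b c) (∙-distribˡ a p q)

  ∙-distribʳ : ∀ p a b → (a R.+ b) ∙ p ≈ a ∙ p + b ∙ p
  ∙-distribʳ []      a b = refl
  ∙-distribʳ (c ∷ p) a b = ∷-cong (R.distribʳ c a b) (∙-distribʳ p a b)

  ∙-assoc : ∀ a b p → (a R.* b) ∙ p ≈ a ∙ (b ∙ p)
  ∙-assoc a b []      = refl
  ∙-assoc a b (c ∷ p) = ∷-cong (R.*-assoc a b c) (∙-assoc a b p)

  +-isSemigroup : IsSemigroup _≈_ _+_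
  +-isSemigroup = record
    { isMagma = record { isEquivalence = isEquivalence ; ∙-cong = +-cong }
    ; assoc   = +-assoc
    }

  +-commutativeSemigroup : CommutativeSemigroup c ℓ
  +-commutativeSemigroup = record
    { isCommutativeSemigroup = record { isSemigroup = +-isSemigroup ; comm = +-comm } }

  open CommutativeSemigroupProperties +-commutativeSemigroup using (interchange; x∙yz≈y∙xz)

  *-congˡ : ∀ p {q q′} → q ≈ q′ → p * q ≈ p * q′
  *-congˡ []      q≈q′ = refl
  *-congˡ (a ∷ p) q≈q′ = +-cong (∙-cong R.refl q≈q′) (∷-cong R.refl (*-congˡ p q≈q′))

  *-zeroʳ : ∀ p → p * [] ≈ []
  *-zeroʳ []      = refl
  *-zeroʳ (a ∷ p) = trans (∷-cong R.refl (*-zeroʳ p)) 0∷0≈0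

  -- The mirror image of the defining clause of `_*_`, splitting the second factor instead of the
  -- first; commutativity is then a plain induction.
  *-∷ : ∀ p b q → p * (b ∷ q) ≈ b ∙ p + (R.0# ∷ p * q)
  *-∷ []      b q = sym 0∷0≈0
  *-∷ (a ∷ p) b q = ∷-cong (R.+-congʳ (R.*-comm a b)) (begin
    a ∙ q + p * (b ∷ q)               ≈⟨ +-cong refl (*-∷ p b q) ⟩
    a ∙ q + (b ∙ p + (R.0# ∷ p * q))  ≈⟨ x∙yz≈y∙xz (a ∙ q) (b ∙ p) _ ⟩
    b ∙ p + (a ∙ q + (R.0# ∷ p * q))  ∎)

  *-comm : ∀ p q → p * q ≈ q * p
  *-comm []      q = sym (*-zeroʳ q)
  *-comm (a ∷ p) q = begin
    a ∙ q + (R.0# ∷ p * q)  ≈⟨ +-cong refl (∷-cong R.refl (*-comm p q)) ⟩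
    a ∙ q + (R.0# ∷ q * p)  ≈⟨ *-∷ q a p ⟨
    q * (a ∷ p)             ∎

  -- Equal polynomials may have lists of different lengths, which a recursion on the first factor
  -- would have to match. Commutativity moves the change to the second factor, where `*-congˡ`
  -- applies.
  *-cong : ∀ {p p′ q q′} → p ≈ p′ → q ≈ q′ → p * q ≈ p′ * q′
  *-cong {p} {p′} {q} {q′} p≈p′ q≈q′ = begin
    p * q    ≈⟨ *-congˡ p q≈q′ ⟩
    p * q′   ≈⟨ *-comm p q′ ⟩
    q′ * p   ≈⟨ *-congˡ q′ p≈p′ ⟩
    q′ * p′  ≈⟨ *-comm q′ p′ ⟩
    p′ * q′  ∎

  *-distribʳ : ∀ r p q → (p + q) * r ≈ p * r + q * r
  *-distribʳ r []      q       = refl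
  *-distribʳ r (a ∷ p) []      = sym (+-identityʳ _)
  *-distribʳ r (a ∷ p) (b ∷ q) = begin
    (a R.+ b) ∙ r + (R.0# ∷ (p + q) * r)
      ≈⟨ +-cong (∙-distribʳ r a b) (∷-cong (R.sym (R.+-identityˡ _)) (*-distribʳ r p q)) ⟩
    (a ∙ r + b ∙ r) + ((R.0# ∷ p * r) + (R.0# ∷ q * r))
      ≈⟨ interchange (a ∙ r) (b ∙ r) _ _ ⟩
    (a ∙ r + (R.0# ∷ p * r)) + (b ∙ r + (R.0# ∷ q * r)) ∎

  *-distribˡ : ∀ r p q → r * (p + q) ≈ r * p + r * q
  *-distribˡ r p q = begin
    r * (p + q)    ≈⟨ *-comm r (p + q) ⟩
    (p + q) * r    ≈⟨ *-distribʳ r p q ⟩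
    p * r + q * r  ≈⟨ +-cong (*-comm p r) (*-comm q r) ⟩
    r * p + r * q  ∎

  ∙-*-assoc : ∀ a p q → (a ∙ p) * q ≈ a ∙ (p * q)
  ∙-*-assoc a []      q = refl
  ∙-*-assoc a (b ∷ p) q = begin
    (a R.* b) ∙ q + (R.0# ∷ (a ∙ p) * q)
      ≈⟨ +-cong (∙-assoc a b q) (∷-cong (R.sym (R.zeroʳ a)) (∙-*-assoc a p q)) ⟩
    a ∙ (b ∙ q) + a ∙ (R.0# ∷ p * q)
      ≈⟨ ∙-distribˡ a (b ∙ q) _ ⟨
    a ∙ (b ∙ q + (R.0# ∷ p * q)) ∎

  0∷-* : ∀ p q → (R.0# ∷ p) * q ≈ R.0# ∷ p * q
  0∷-* p q = +-cong (∙-zeroˡ q) refl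

  *-assoc : ∀ p q r → (p * q) * r ≈ p * (q * r)
  *-assoc []      q r = refl
  *-assoc (a ∷ p) q r = begin
    (a ∙ q + (R.0# ∷ p * q)) * r
      ≈⟨ *-distribʳ r (a ∙ q) _ ⟩
    (a ∙ q) * r + (R.0# ∷ p * q) * r
      ≈⟨ +-cong (∙-*-assoc a q r) (trans (0∷-* (p * q) r) (∷-cong R.refl (*-assoc p q r))) ⟩
    a ∙ (q * r) + (R.0# ∷ p * (q * r)) ∎

  *-identityˡ : ∀ p → const R.1# * p ≈ p
  *-identityˡ p = begin
    R.1# ∙ p + (R.0# ∷ [])  ≈⟨ +-cong (∙-identityˡ p) 0∷0≈0 ⟩
    p + []                  ≈⟨ +-identityʳ p ⟩
    p                       ∎

  commutativeRing : CommutativeRing c ℓ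
  commutativeRing = record
    { RawRing′
    ; isCommutativeRing = record
      { isRing = record
        { +-isAbelianGroup = record
          { isGroup = record
            { isMonoid = record
              { isSemigroup = +-isSemigroup
              ; identity = (λ _ → refl) , +-identityʳ
              }
            ; inverse = -‿inverseˡ , λ p → trans (+-comm p (-‿ p)) (-‿inverseˡ p)
            ; ⁻¹-cong = -‿cong
            }
          ; comm = +-comm
          }
        ; *-cong     = *-cong
        ; *-assoc    = *-assoc
        ; *-identity = *-identityˡ , λ p → trans (*-comm p (const R.1#)) (*-identityˡ p)
        ; distrib    = *-distribˡ , *-distribʳ
        }
      ; *-comm = *-comm
      }
    }
    where module RawRing′ = RawRing rawRing

-- Splitting off the first letter of a permutation.

module Permutations where

  open import Data.Nat.Base using (_+_; _⊔_)
  open ≡ using (refl; sym; trans; cong; cong₂; subst; _≢_; setoid; module ≡-Reasoning)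
  open Equivalence using (to; from)

  private variable
    ℓ₁ ℓ₂ : Level
    A B D E W : Set ℓ₁
    k m n N N′ : ℕ

  module _ {P : Pred B ℓ₁} (P? : Decidable P) (f : A → B) where

    filter-map : ∀ xs → List.filter P? (List.map f xs) ≡ List.map f (List.filter (P? ∘ f) xs)
    filter-map []       = refl
    filter-map (x ∷ xs) with does (P? (f x))
    ... | true  = cong (f x ∷_) (filter-map xs)
    ... | false = filter-map xs

  filter-filter : {P : Pred A ℓ₁} (P? : Decidable P) {Q : Pred A ℓ₂} (Q? : Decidable Q) →
    ∀ xs → List.filter Q? (List.filter P? xs) ≡ List.filter (λ x → P? x ×-dec Q? x) xs
  filter-filter P? Q? []       = refl
  filter-filter P? Q? (x ∷ xs) with does (P? x)
  ... | false = filter-filter P? Q? xs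
  ... | true  with does (Q? x)
  ...   | true  = cong (x ∷_) (filter-filter P? Q? xs)
  ...   | false = filter-filter P? Q? xs

  filter-cartesianProductWith : {P : Pred W ℓ₁} (P? : Decidable P)
    (f : A → B → W) (g : A → D → W) (bs : List B) (ds : List D) →
    (∀ a → List.filter P? (List.map (f a) bs) ≡ List.map (g a) ds) →
    ∀ as → List.filter P? (List.cartesianProductWith f as bs) ≡ List.cartesianProductWith g as ds
  filter-cartesianProductWith P? f g bs ds eq []       = refl
  filter-cartesianProductWith P? f g bs ds eq (a ∷ as) = trans
    (List.filter-++ P? (List.map (f a) bs) _)
    (cong₂ _++_ (eq a) (filter-cartesianProductWith P? f g bs ds eq as))

  filter-vecs : {P : Pred A ℓ₁} (P? : Decidable P) (as : List A) →
    ∀ m → List.filter (All.all? P?) (vecs as m) ≡ vecs (List.filter P? as) m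
  filter-vecs             P? as zero    = refl
  filter-vecs {A = A} {P = P} P? as (suc m) = go as
    where
    V V′ : List (Vec A m)
    V  = vecs as m
    V′ = vecs (List.filter P? as) m

    go : ∀ bs → List.filter (All.all? P?) (List.cartesianProductWith _∷_ bs V)
              ≡ List.cartesianProductWith _∷_ (List.filter P? bs) V′
    go []       = refl
    go (b ∷ bs) with P? b
    ... | yes Pb = trans (List.filter-++ (All.all? P?) (List.map (b ∷_) V) _) (cong₂ _++_ (begin
      List.filter (All.all? P?) (List.map (b ∷_) V)
        ≡⟨ filter-map (All.all? P?) (b ∷_) V ⟩
      List.map (b ∷_) (List.filter (All.all? P? ∘ (b ∷_)) V)
        ≡⟨ cong (List.map (b ∷_)) (List.filter-≐ (All.all? P? ∘ (b ∷_)) (All.all? P?) (All.tail , Pb ∷_) V) ⟩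
      List.map (b ∷_) (List.filter (All.all? P?) V)
        ≡⟨ cong (List.map (b ∷_)) (filter-vecs P? as m) ⟩
      List.map (b ∷_) V′ ∎) (go bs))
      where open ≡-Reasoning
    ... | no ¬Pb = trans (List.filter-++ (All.all? P?) (List.map (b ∷_) V) _)
      (cong₂ _++_ (List.filter-none (All.all? P?) (ListAll.map⁺ (ListAll.universal (λ v → ¬Pb ∘ All.head) V))) (go bs))

  cartesianProductWith-map :
    (f : B → D → E) (g : A → B) (h : W → D) (as : List A) (cs : List W) →
    List.cartesianProductWith f (List.map g as) (List.map h cs)
      ≡ List.cartesianProductWith (λ a c → f (g a) (h c)) as cs
  cartesianProductWith-map f g h []       cs = refl
  cartesianProductWith-map f g h (a ∷ as) cs =
    cong₂ _++_ (sym (List.map-∘ cs)) (cartesianProductWith-map f g h as cs)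

  map-cartesianProductWith : (f : W → D) (g : A → B → W) (as : List A) (bs : List B) →
    List.map f (List.cartesianProductWith g as bs) ≡ List.cartesianProductWith (λ a b → f (g a b)) as bs
  map-cartesianProductWith f g []       bs = refl
  map-cartesianProductWith f g (a ∷ as) bs = trans (List.map-++ f (List.map (g a) bs) _)
    (cong₂ _++_ (sym (List.map-∘ bs)) (map-cartesianProductWith f g as bs))

  vecs-map : (f : A → B) (as : List A) → ∀ m → vecs (List.map f as) m ≡ List.map (Vec.map f) (vecs as m)
  vecs-map f as zero    = refl
  vecs-map f as (suc m) = begin
    List.cartesianProductWith _∷_ (List.map f as) (vecs (List.map f as) m)
      ≡⟨ cong (List.cartesianProductWith _∷_ (List.map f as)) (vecs-map f as m) ⟩
    List.cartesianProductWith _∷_ (List.map f as) (List.map (Vec.map f) (vecs as m))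
      ≡⟨ cartesianProductWith-map _∷_ f (Vec.map f) as (vecs as m) ⟩
    List.cartesianProductWith (λ a v → f a ∷ Vec.map f v) as (vecs as m)
      ≡⟨ map-cartesianProductWith (Vec.map f) _∷_ as (vecs as m) ⟨
    List.map (Vec.map f) (vecs as (suc m)) ∎
    where open ≡-Reasoning

  allFin-punchIn : (a : Fin (suc n)) →
    List.filter (λ b → ¬? (a Fin.≟ b)) (allFin (suc n)) ≡ List.map (punchIn a) (allFin n)
  allFin-punchIn {n} Fin.zero = trans
    (List.filter-all (λ b → ¬? (Fin.zero Fin.≟ b)) (ListAll.tabulate⁺ {n = n} {f = Fin.suc} λ i → λ ()))
    (sym (List.map-tabulate id Fin.suc))
  allFin-punchIn {suc n} (Fin.suc a) = cong (Fin.zero ∷_) (begin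
    List.filter (λ b → ¬? (Fin.suc a Fin.≟ b)) (List.tabulate Fin.suc)
      ≡⟨ cong (List.filter λ b → ¬? (Fin.suc a Fin.≟ b)) (List.map-tabulate id Fin.suc) ⟨
    List.filter (λ b → ¬? (Fin.suc a Fin.≟ b)) (List.map Fin.suc (allFin (suc n)))
      ≡⟨ filter-map (λ b → ¬? (Fin.suc a Fin.≟ b)) Fin.suc (allFin (suc n)) ⟩
    List.map Fin.suc (List.filter (λ b → ¬? (Fin.suc a Fin.≟ Fin.suc b)) (allFin (suc n)))
      ≡⟨ cong (List.map Fin.suc) (List.filter-≐ (λ b → ¬? (Fin.suc a Fin.≟ Fin.suc b)) (λ b → ¬? (a Fin.≟ b))
           ((λ ≢ → ≢ ∘ cong Fin.suc) , (λ ≢ → ≢ ∘ Fin.suc-injective)) (allFin (suc n))) ⟩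
    List.map Fin.suc (List.filter (λ b → ¬? (a Fin.≟ b)) (allFin (suc n)))
      ≡⟨ cong (List.map Fin.suc) (allFin-punchIn a) ⟩
    List.map Fin.suc (List.map (punchIn a) (allFin n))
      ≡⟨ List.map-∘ (allFin n) ⟨
    List.map (Fin.suc ∘ punchIn a) (allFin n)
      ≡⟨ List.map-∘ (allFin n) ⟩
    List.map (punchIn (Fin.suc a)) (List.map Fin.suc (allFin n))
      ≡⟨ cong (List.map (punchIn (Fin.suc a))) (List.map-tabulate id Fin.suc) ⟩
    List.map (punchIn (Fin.suc a)) (List.tabulate Fin.suc) ∎)
    where open ≡-Reasoning

  -- The word with first letter a whose tail standardises to τ.
  insert : Fin (suc n) → Vec (Fin n) m → Vec (Fin (suc n)) (suc m)
  insert a τ = a ∷ Vec.map (punchIn a) τ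

  -- An equality of lists, order included: both sides are in lexicographic order, because
  -- `punchIn a` enumerates the letters other than `a` increasingly.
  𝔖-suc : ∀ n → 𝔖 (suc n) ≡ List.cartesianProductWith insert (allFin (suc n)) (𝔖 n)
  𝔖-suc n = filter-cartesianProductWith unique? _∷_ insert V (𝔖 n) prepend (allFin (suc n))
    where
    V : List (Vec (Fin (suc n)) n)
    V = vecs (allFin (suc n)) n

    distinct? : Decidable {A = Vec (Fin k) m} Unique
    distinct? = allPairs? (λ a b → ¬? (a Fin.≟ b))

    open ≡-Reasoning

    prepend : ∀ a → List.filter unique? (List.map (a ∷_) V) ≡ List.map (insert a) (𝔖 n)
    prepend a = begin
      List.filter unique? (List.map (a ∷_) V)
        ≡⟨ filter-map unique? (a ∷_) V ⟩
      List.map (a ∷_) (List.filter (unique? ∘ (a ∷_)) V)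
        ≡⟨ cong (List.map (a ∷_)) (List.filter-≐ (unique? ∘ (a ∷_)) (λ v → ≢a? v ×-dec distinct? v)
             (AllPairs.uncons , uncurry _∷_) V) ⟩
      List.map (a ∷_) (List.filter (λ v → ≢a? v ×-dec distinct? v) V)
        ≡⟨ cong (List.map (a ∷_)) (filter-filter ≢a? distinct? V) ⟨
      List.map (a ∷_) (List.filter distinct? (List.filter ≢a? V))
        ≡⟨ cong (List.map (a ∷_) ∘ List.filter distinct?) (begin
             List.filter ≢a? V
               ≡⟨ filter-vecs (λ b → ¬? (a Fin.≟ b)) (allFin (suc n)) n ⟩
             vecs (List.filter (λ b → ¬? (a Fin.≟ b)) (allFin (suc n))) n
               ≡⟨ cong (λ as → vecs as n) (allFin-punchIn a) ⟩
             vecs (List.map (punchIn a) (allFin n)) n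
               ≡⟨ vecs-map (punchIn a) (allFin n) n ⟩
             List.map (Vec.map (punchIn a)) (vecs (allFin n) n) ∎) ⟩
      List.map (a ∷_) (List.filter distinct? (List.map (Vec.map (punchIn a)) (vecs (allFin n) n)))
        ≡⟨ cong (List.map (a ∷_)) (filter-map distinct? (Vec.map (punchIn a)) (vecs (allFin n) n)) ⟩
      List.map (a ∷_) (List.map (Vec.map (punchIn a))
        (List.filter (distinct? ∘ Vec.map (punchIn a)) (vecs (allFin n) n)))
        ≡⟨ List.map-∘ _ ⟨
      List.map (insert a) (List.filter (distinct? ∘ Vec.map (punchIn a)) (vecs (allFin n) n))
        ≡⟨ cong (List.map (insert a)) (List.filter-≐ (distinct? ∘ Vec.map (punchIn a)) unique?
             (unmap , AllPairs.map⁺ ∘ AllPairs.map (λ ≢ → ≢ ∘ Fin.punchIn-injective a _ _)) (vecs (allFin n) n)) ⟩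
      List.map (insert a) (𝔖 n) ∎
      where
      ≢a? : Decidable {A = Vec (Fin (suc n)) m} (All (a ≢_))
      ≢a? = All.all? (λ b → ¬? (a Fin.≟ b))

      unmap : {v : Vec (Fin n) m} → Unique (Vec.map (punchIn a) v) → Unique v
      unmap {v = []}    []       = []
      unmap {v = _ ∷ _} (≢ ∷ ≢s) = All.map (_∘ cong (punchIn a)) (All.map⁻ ≢) ∷ unmap ≢s

  count : {P : Pred A ℓ₁} → Decidable P → List A → ℕ
  count P? xs = List.length (List.filter P? xs)

  count-≐ : {P : Pred A ℓ₁} (P? : Decidable P) {Q : Pred A ℓ₂} (Q? : Decidable Q) →
    P ≐ Q → ∀ xs → count P? xs ≡ count Q? xs
  count-≐ P? Q? P≐Q xs = cong List.length (List.filter-≐ P? Q? P≐Q xs)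

  count-map : {P : Pred B ℓ₁} (P? : Decidable P) {Q : Pred A ℓ₂} (Q? : Decidable Q) {f : A → B} →
    (∀ x → P (f x) ⇔ Q x) →
    ∀ xs → count P? (List.map f xs) ≡ count Q? xs
  count-map P? Q? {f} P⇔Q xs = begin
    count P? (List.map f xs)
      ≡⟨ cong List.length (filter-map P? f xs) ⟩
    List.length (List.map f (List.filter (P? ∘ f) xs))
      ≡⟨ List.length-map f (List.filter (P? ∘ f) xs) ⟩
    count (P? ∘ f) xs
      ≡⟨ count-≐ (P? ∘ f) Q? ((λ {x} → to (P⇔Q x)) , λ {x} → from (P⇔Q x)) xs ⟩
    count Q? xs ∎
    where open ≡-Reasoning

  count-++ : {P : Pred A ℓ₁} (P? : Decidable P) (xs ys : List A) →
    count P? (xs ++ ys) ≡ count P? xs + count P? ys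
  count-++ P? xs ys = trans (cong List.length (List.filter-++ P? xs ys)) (List.length-++ (List.filter P? xs))

  tabulate-suc : ∀ n → List.tabulate Fin.suc ≡ List.map Fin.suc (allFin n)
  tabulate-suc n = sym (List.map-tabulate id Fin.suc)

  -- Recursive forms of the statistics and of 321-avoidance.

  infix 4 _≺_
  _≺_ : Fin N → ℕ → Set
  a ≺ p = toℕ a < p

  _≺?_ : (a : Fin N) (p : ℕ) → Dec (a ≺ p)
  a ≺? p = toℕ a ℕ.<? p

  below : ℕ → Vec (Fin N) m → ℕ
  below p []      = 0
  below p (a ∷ v) = (if does (a ≺? p) then 1 else 0) + below p v

  invᵣ : Vec (Fin N) m → ℕ
  invᵣ []      = 0
  invᵣ (a ∷ v) = below (toℕ a) v + invᵣ v

  -- lrmᵣ and Avᵣ treat v as a tail of a longer word whose preceding maximum is recorded by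
  -- h: a letter ≺ h is not a left-right maximum, and no letter ≺ h may be followed by a
  -- smaller one.  As v may have repeated letters, h is the maximum itself for Avᵣ but its
  -- successor for lrmᵣ; on permutations the two choices become equivalent.
  lrmᵣ : ℕ → Vec (Fin N) m → ℕ
  lrmᵣ h []      = 0
  lrmᵣ h (a ∷ v) = (if does (a ≺? h) then 0 else 1) + lrmᵣ (h ⊔ suc (toℕ a)) v

  Avᵣ : ℕ → Vec (Fin N) m → Set
  Avᵣ h []      = ⊤
  Avᵣ h (a ∷ v) = (a ≺ h → All (λ b → ¬ b ≺ toℕ a) v) × Avᵣ (h ⊔ toℕ a) v

  avᵣ? : ∀ h (v : Vec (Fin N) m) → Dec (Avᵣ h v)
  avᵣ? h []      = yes tt
  avᵣ? h (a ∷ v) = (a ≺? h →-dec All.all? (λ b → ¬? (b ≺? toℕ a)) v) ×-dec avᵣ? (h ⊔ toℕ a) v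

  below-allFin : ∀ p (v : Vec (Fin N) m) →
    count (λ i → lookup v i ≺? p) (allFin m) ≡ below p v
  below-allFin         p []      = refl
  below-allFin {m = suc m} p (a ∷ v) = helper
    where
    rest : count (λ i → lookup (a ∷ v) i ≺? p) (List.tabulate Fin.suc) ≡ below p v
    rest = begin
      count (λ i → lookup (a ∷ v) i ≺? p) (List.tabulate Fin.suc)
        ≡⟨ cong (List.length ∘ List.filter _) (tabulate-suc m) ⟩
      count (λ i → lookup (a ∷ v) i ≺? p) (List.map Fin.suc (allFin m))
        ≡⟨ count-map (λ i → lookup (a ∷ v) i ≺? p) (λ i → lookup v i ≺? p) (λ _ → mk⇔ id id) (allFin m) ⟩
      count (λ i → lookup v i ≺? p) (allFin m)
        ≡⟨ below-allFin p v ⟩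
      below p v ∎
      where open ≡-Reasoning

    helper : count (λ i → lookup (a ∷ v) i ≺? p) (allFin (suc m)) ≡ below p (a ∷ v)
    helper with does (a ≺? p)
    ... | true  = cong suc rest
    ... | false = rest

  module _ (v : Vec (Fin N) m) where

    Inversionᵥ : Fin m × Fin m → Set
    Inversionᵥ (i , j) = i Fin.< j × lookup v j Fin.< lookup v i

    inversionᵥ? : Decidable Inversionᵥ
    inversionᵥ? (i , j) = i Fin.<? j ×-dec lookup v j Fin.<? lookup v i

    LRMaxᵥ : ℕ → Fin m → Set
    LRMaxᵥ h i = ¬ lookup v i ≺ h × (∀ j → j Fin.< i → lookup v j Fin.< lookup v i)

    lrMaxᵥ? : ∀ h → Decidable (LRMaxᵥ h)
    lrMaxᵥ? h i = ¬? (lookup v i ≺? h) ×-dec Fin.all? λ j → j Fin.<? i →-dec lookup v j Fin.<? lookup v i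

    Contains321ᵥ : Set
    Contains321ᵥ = ∃ λ i → ∃ λ j → ∃ λ l →
      (i Fin.< j × j Fin.< l) × (lookup v j Fin.< lookup v i × lookup v l Fin.< lookup v j)

    Contains21Below : ℕ → Set
    Contains21Below h = ∃ λ i → ∃ λ j → i Fin.< j × lookup v i ≺ h × lookup v j Fin.< lookup v i

  length-inversions : (v : Vec (Fin N) m) →
    count (inversionᵥ? v) (List.cartesianProduct (allFin m) (allFin m)) ≡ invᵣ v
  length-inversions []                = refl
  length-inversions {m = suc m} (a ∷ v) = begin
    count I? (List.map (Fin.zero ,_) Is ++ List.cartesianProduct (List.tabulate Fin.suc) Is)
      ≡⟨ count-++ I? (List.map (Fin.zero ,_) Is) _ ⟩
    count I? (List.map (Fin.zero ,_) Is)
      + count I? (List.cartesianProduct (List.tabulate Fin.suc) Is)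
      ≡⟨ cong₂ _+_ first-row (cong (λ is → count I? (List.cartesianProduct is Is)) (tabulate-suc m)) ⟩
    below (toℕ a) v + count I? (List.cartesianProduct (List.map Fin.suc (allFin m)) Is)
      ≡⟨ cong (below (toℕ a) v +_) (trans (other-rows (allFin m)) (length-inversions v)) ⟩
    below (toℕ a) v + invᵣ v ∎
    where
    open ≡-Reasoning

    Is : List (Fin (suc m))
    Is = allFin (suc m)

    I? = inversionᵥ? (a ∷ v)

    row : ∀ i → count I? (List.map (i ,_) Is)
              ≡ count (λ j → I? (i , Fin.suc j)) (allFin m)
    row i = begin
      count I? (List.map (i ,_) Is)
        ≡⟨ cong List.length
             (List.filter-reject I? {x = i , Fin.zero} {xs = List.map (i ,_) (List.tabulate Fin.suc)} λ ()) ⟩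
      count I? (List.map (i ,_) (List.tabulate Fin.suc))
        ≡⟨ cong (List.length ∘ List.filter I? ∘ List.map (i ,_)) (tabulate-suc m) ⟩
      count I? (List.map (i ,_) (List.map Fin.suc (allFin m)))
        ≡⟨ cong (List.length ∘ List.filter I?) (List.map-∘ (allFin m)) ⟨
      count I? (List.map (λ j → i , Fin.suc j) (allFin m))
        ≡⟨ count-map I? (λ j → I? (i , Fin.suc j)) (λ _ → mk⇔ id id) (allFin m) ⟩
      count (λ j → I? (i , Fin.suc j)) (allFin m) ∎

    first-row : count I? (List.map (Fin.zero ,_) Is) ≡ below (toℕ a) v
    first-row = begin
      count I? (List.map (Fin.zero ,_) Is)
        ≡⟨ row Fin.zero ⟩
      count (λ j → I? (Fin.zero , Fin.suc j)) (allFin m)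
        ≡⟨ count-≐ _ (λ j → lookup v j ≺? toℕ a) (proj₂ , (z<s ,_)) (allFin m) ⟩
      count (λ j → lookup v j ≺? toℕ a) (allFin m)
        ≡⟨ below-allFin (toℕ a) v ⟩
      below (toℕ a) v ∎

    other-rows : ∀ is → count I? (List.cartesianProduct (List.map Fin.suc is) Is)
                      ≡ count (inversionᵥ? v) (List.cartesianProduct is (allFin m))
    other-rows []       = refl
    other-rows (i ∷ is) = begin
      count I? (List.map (Fin.suc i ,_) Is ++ List.cartesianProduct (List.map Fin.suc is) Is)
        ≡⟨ count-++ I? (List.map (Fin.suc i ,_) Is) _ ⟩
      count I? (List.map (Fin.suc i ,_) Is)
        + count I? (List.cartesianProduct (List.map Fin.suc is) Is)
        ≡⟨ cong₂ _+_
             (trans (row (Fin.suc i))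
               (trans (count-≐ _ (λ j → inversionᵥ? v (i , j))
                 ((λ (i<j , b) → s<s⁻¹ i<j , b) , λ (i<j , b) → s<s i<j , b) (allFin m))
                 (sym (count-map (inversionᵥ? v) _ (λ _ → mk⇔ id id) (allFin m)))))
             (other-rows is) ⟩
      count (inversionᵥ? v) (List.map (i ,_) (allFin m))
        + count (inversionᵥ? v) (List.cartesianProduct is (allFin m))
        ≡⟨ count-++ (inversionᵥ? v) (List.map (i ,_) (allFin m)) _ ⟨
      count (inversionᵥ? v) (List.cartesianProduct (i ∷ is) (allFin m)) ∎

  inv≡invᵣ : (σ : Word n) → inv σ ≡ invᵣ σ
  inv≡invᵣ σ = trans
    (count-≐ (inversion? σ) (inversionᵥ? σ) (id , id) (List.cartesianProduct (allFin _) (allFin _)))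
    (length-inversions σ)

  <-⊔⁻ : ∀ {k} m n → k < m ⊔ n → ¬ k < m → k < n
  <-⊔⁻ {k} m n k<m⊔n k≮m with ℕ.⊔-sel m n
  ... | inj₁ ≡m = contradiction (subst (k <_) ≡m k<m⊔n) k≮m
  ... | inj₂ ≡n = subst (k <_) ≡n k<m⊔n

  -- A letter exceeds `a` exactly when it is not `≺ suc (toℕ a)`. So the comparison with the first
  -- letter is absorbed into the threshold, which explains the successor in `lrmᵣ`.
  LRMaxᵥ-suc : ∀ h a (v : Vec (Fin N) m) i → LRMaxᵥ (a ∷ v) h (Fin.suc i) ⇔ LRMaxᵥ v (h ⊔ suc (toℕ a)) i
  LRMaxᵥ-suc h a v i = mk⇔
    (λ (b≮h , max) →
        (λ b<h⊔a → ℕ.<⇒≱ (<-⊔⁻ h (suc (toℕ a)) b<h⊔a b≮h) (max Fin.zero z<s))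
      , (λ j j<i → max (Fin.suc j) (s<s j<i)))
    (λ (b≮h⊔a , max) →
        (λ b<h → b≮h⊔a (ℕ.m<n⇒m<n⊔o (suc (toℕ a)) b<h))
      , λ { Fin.zero    _   → ℕ.≰⇒> (λ b≤a → b≮h⊔a (ℕ.m<n⇒m<o⊔n h (s≤s b≤a)))
          ; (Fin.suc j) j<i → max j (s<s⁻¹ j<i) })

  length-lrMaxs : ∀ h (v : Vec (Fin N) m) →
    count (lrMaxᵥ? v h) (allFin m) ≡ lrmᵣ h v
  length-lrMaxs h []                  = refl
  length-lrMaxs {m = suc m} h (a ∷ v) = helper
    where
    rest : count (lrMaxᵥ? (a ∷ v) h) (List.tabulate Fin.suc) ≡ lrmᵣ (h ⊔ suc (toℕ a)) v
    rest = begin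
      count (lrMaxᵥ? (a ∷ v) h) (List.tabulate Fin.suc)
        ≡⟨ cong (List.length ∘ List.filter (lrMaxᵥ? (a ∷ v) h)) (tabulate-suc m) ⟩
      count (lrMaxᵥ? (a ∷ v) h) (List.map Fin.suc (allFin m))
        ≡⟨ count-map (lrMaxᵥ? (a ∷ v) h) (lrMaxᵥ? v (h ⊔ suc (toℕ a))) (LRMaxᵥ-suc h a v) (allFin m) ⟩
      count (lrMaxᵥ? v (h ⊔ suc (toℕ a))) (allFin m)
        ≡⟨ length-lrMaxs (h ⊔ suc (toℕ a)) v ⟩
      lrmᵣ (h ⊔ suc (toℕ a)) v ∎
      where open ≡-Reasoning

    helper : count (lrMaxᵥ? (a ∷ v) h) (allFin (suc m)) ≡ lrmᵣ h (a ∷ v)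
    helper with a ≺? h
    ... | yes a<h = trans
      (cong List.length (List.filter-reject (lrMaxᵥ? (a ∷ v) h) {x = Fin.zero} {xs = List.tabulate Fin.suc}
        λ (a≮h , _) → a≮h a<h))
      (trans rest (cong (λ b → (if b then 0 else 1) + lrmᵣ (h ⊔ suc (toℕ a)) v) (sym (dec-true (a ≺? h) a<h))))
    ... | no  a≮h = trans
      (cong List.length (List.filter-accept (lrMaxᵥ? (a ∷ v) h) {x = Fin.zero} {xs = List.tabulate Fin.suc}
        (a≮h , λ _ ())))
      (trans (cong suc rest)
        (cong (λ b → (if b then 0 else 1) + lrmᵣ (h ⊔ suc (toℕ a)) v) (sym (dec-false (a ≺? h) a≮h))))

  lrm≡lrmᵣ : (σ : Word n) → lrm σ ≡ lrmᵣ 0 σ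
  lrm≡lrmᵣ {n} σ = trans
    (count-≐ (lrMax? σ) (lrMaxᵥ? σ 0) (((λ ()) ,_) , proj₂) (allFin n))
    (length-lrMaxs 0 σ)

  -- The induction needs the first conjunct: a 21 below the maximum of the letters already read
  -- completes a 321 whose first letter lies outside `v`. When `a` is read, a 321 starting with `a`
  -- turns into such a 21 for the tail.
  Avᵣ⇒avoids : ∀ h (v : Vec (Fin N) m) → Avᵣ h v → ¬ Contains21Below v h × ¬ Contains321ᵥ v
  Avᵣ⇒avoids h []      _            = (λ ()) , λ ()
  Avᵣ⇒avoids h (a ∷ v) (a≺h⇒ , av) with Avᵣ⇒avoids (h ⊔ toℕ a) v av
  ... | no21 , no321 = no21′ , no321′
    where
    no21′ : ¬ Contains21Below (a ∷ v) h
    no21′ (Fin.zero  , Fin.suc j , _   , a≺h , b) = All.lookup⁺ (a≺h⇒ a≺h) j b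
    no21′ (Fin.suc i , Fin.suc j , i<j , b≺h , b) = no21 (i , j , s<s⁻¹ i<j , ℕ.m<n⇒m<n⊔o (toℕ a) b≺h , b)

    no321′ : ¬ Contains321ᵥ (a ∷ v)
    no321′ (Fin.zero  , Fin.suc j , Fin.suc l , (_   , j<l) , b<a , c<b) =
      no21 (j , l , s<s⁻¹ j<l , ℕ.m<n⇒m<o⊔n h b<a , c<b)
    no321′ (Fin.suc i , Fin.suc j , Fin.suc l , (i<j , j<l) , bs) =
      no321 (i , j , l , (s<s⁻¹ i<j , s<s⁻¹ j<l) , bs)

  avoids⇒Avᵣ : ∀ h (v : Vec (Fin N) m) → ¬ Contains21Below v h → ¬ Contains321ᵥ v → Avᵣ h v
  avoids⇒Avᵣ h []      _    _     = tt
  avoids⇒Avᵣ h (a ∷ v) no21 no321 =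
      (λ a≺h → All.lookup⁻ λ j b → no21 (Fin.zero , Fin.suc j , z<s , a≺h , b))
    , avoids⇒Avᵣ (h ⊔ toℕ a) v
        (λ (i , j , i<j , b≺h⊔a , c<b) → no321
          ( Fin.zero , Fin.suc i , Fin.suc j , (z<s , s<s i<j)
          , <-⊔⁻ h (toℕ a) b≺h⊔a (λ b≺h → no21 (Fin.suc i , Fin.suc j , s<s i<j , b≺h , c<b)) , c<b))
        (λ (i , j , l , (i<j , j<l) , bs) → no321 (Fin.suc i , Fin.suc j , Fin.suc l , (s<s i<j , s<s j<l) , bs))

  avoids321⇔Avᵣ : (σ : Word n) → Avoids321 σ ⇔ Avᵣ 0 σ
  avoids321⇔Avᵣ σ = mk⇔ (avoids⇒Avᵣ 0 σ λ ()) (proj₂ ∘ Avᵣ⇒avoids 0 σ)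

  -- Invariance under increasing relabelling, and the effect of inserting a first letter.

  module _ (φ : Fin N → Fin N′) (mono : ∀ b c → φ b Fin.< φ c ⇔ b Fin.< c) where

    -- All that the statistics see of a threshold is which letters lie below it, so a relabelling
    -- may change `p` to any `q` that cuts the smaller alphabet at the same place.
    Reflects : ℕ → ℕ → Set
    Reflects p q = ∀ b → φ b ≺ p ⇔ b ≺ q

    reflects-suc : ∀ a → Reflects (suc (toℕ (φ a))) (suc (toℕ a))
    reflects-suc a b = mk⇔
      (λ φb≤φa → ℕ.≰⇒> λ a<b → ℕ.<⇒≱ (from (mono a b) a<b) (s≤s⁻¹ φb≤φa))
      (λ b≤a → ℕ.≰⇒> λ φa<φb → ℕ.<⇒≱ (to (mono a b) φa<φb) (s≤s⁻¹ b≤a))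

    reflects-⊔ : ∀ {p q p′ q′} → Reflects p q → Reflects p′ q′ → Reflects (p ⊔ p′) (q ⊔ q′)
    reflects-⊔ {p} {q} {p′} {q′} r r′ b = mk⇔
      (helper p p′ q q′ (to (r b)) (to (r′ b)))
      (helper q q′ p p′ (from (r b)) (from (r′ b)))
      where
      helper : ∀ {c d} p p′ q q′ → (c < p → d < q) → (c < p′ → d < q′) → c < p ⊔ p′ → d < q ⊔ q′
      helper {c} p p′ q q′ f g c<p⊔p′ with c ℕ.<? p
      ... | yes c<p = ℕ.m<n⇒m<n⊔o q′ (f c<p)
      ... | no  c≮p = ℕ.m<n⇒m<o⊔n q (g (<-⊔⁻ p p′ c<p⊔p′ c≮p))

    below-map : ∀ {p q} → Reflects p q → (v : Vec (Fin N) m) → below p (Vec.map φ v) ≡ below q v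
    below-map         r []      = refl
    below-map {p = p} {q} r (a ∷ v)
      rewrite does-⇔ (r a) (φ a ≺? p) (a ≺? q) = cong (_ +_) (below-map r v)

    invᵣ-map : (v : Vec (Fin N) m) → invᵣ (Vec.map φ v) ≡ invᵣ v
    invᵣ-map []      = refl
    invᵣ-map (a ∷ v) = cong₂ _+_ (below-map (λ b → mono b a) v) (invᵣ-map v)

    lrmᵣ-map : ∀ {p q} → Reflects p q → (v : Vec (Fin N) m) → lrmᵣ p (Vec.map φ v) ≡ lrmᵣ q v
    lrmᵣ-map         r []      = refl
    lrmᵣ-map {p = p} {q} r (a ∷ v)
      rewrite does-⇔ (r a) (φ a ≺? p) (a ≺? q) = cong (_ +_) (lrmᵣ-map (reflects-⊔ r (reflects-suc a)) v)

    Avᵣ-map : ∀ {p q} → Reflects p q → (v : Vec (Fin N) m) → Avᵣ p (Vec.map φ v) ⇔ Avᵣ q v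
    Avᵣ-map r []      = mk⇔ id id
    Avᵣ-map r (a ∷ v) with Avᵣ-map (reflects-⊔ r (λ b → mono b a)) v
    ... | ih = mk⇔
      (λ (f , av) → (λ a≺q → All.map (_∘ from (mono _ a)) (All.map⁻ (f (from (r a) a≺q)))) , to ih av)
      (λ (f , av) → (λ a≺p → All.map⁺ (All.map (_∘ to (mono _ a)) (f (to (r a) a≺p)))) , from ih av)

  punchIn-mono-< : (a : Fin (suc n)) → ∀ b c → punchIn a b Fin.< punchIn a c ⇔ b Fin.< c
  punchIn-mono-< a b c = mk⇔
    (λ lt → ℕ.≰⇒> λ c≤b → ℕ.<⇒≱ lt (Fin.punchIn-mono-≤ a c b c≤b))
    (λ lt → ℕ.≰⇒> λ c≤b → ℕ.<⇒≱ lt (Fin.punchIn-cancel-≤ a c b c≤b))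

  punchIn-≺-≤ : ∀ {p} (a : Fin (suc n)) → p ≤ toℕ a → ∀ b → punchIn a b ≺ p ⇔ b ≺ p
  punchIn-≺-≤             Fin.zero    z≤n       b           = mk⇔ (λ ()) (λ ())
  punchIn-≺-≤             (Fin.suc a) _         Fin.zero    = mk⇔ id id
  punchIn-≺-≤ {p = zero}  (Fin.suc a) _         (Fin.suc b) = mk⇔ (λ ()) (λ ())
  punchIn-≺-≤ {p = suc p} (Fin.suc a) (s≤s p≤a) (Fin.suc b) with punchIn-≺-≤ a p≤a b
  ... | ih = mk⇔ (s<s ∘ to ih ∘ s<s⁻¹) (s<s ∘ from ih ∘ s<s⁻¹)

  -- Together with `punchIn-≺-≤`: once the letter `a` is gone, the thresholds `toℕ a` and
  -- `suc (toℕ a)` cut the remaining letters at the same place and both become `toℕ a`. This is how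
  -- the conventions for `h` in `Avᵣ` and `lrmᵣ` are reconciled.
  punchIn-≺-≥ : ∀ {p} (a : Fin (suc n)) → toℕ a ≤ p → ∀ b → punchIn a b ≺ suc p ⇔ b ≺ p
  punchIn-≺-≥ Fin.zero    _         b           = mk⇔ s<s⁻¹ s<s
  punchIn-≺-≥ (Fin.suc a) (s≤s a≤p) Fin.zero    = mk⇔ (λ _ → z<s) (λ _ → z<s)
  punchIn-≺-≥ (Fin.suc a) (s≤s a≤p) (Fin.suc b) with punchIn-≺-≥ a a≤p b
  ... | ih = mk⇔ (s<s ∘ to ih ∘ s<s⁻¹) (s<s ∘ from ih ∘ s<s⁻¹)

  module _ (a : Fin (suc n)) (τ : Vec (Fin n) m) where

    invᵣ-insert : invᵣ (insert a τ) ≡ below (toℕ a) τ + invᵣ τ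
    invᵣ-insert = cong₂ _+_
      (below-map (punchIn a) (punchIn-mono-< a) (punchIn-≺-≤ a ℕ.≤-refl) τ)
      (invᵣ-map (punchIn a) (punchIn-mono-< a) τ)

    Avᵣ-insert-≥ : ∀ {h} → h ≤ toℕ a → Avᵣ h (insert a τ) ⇔ Avᵣ (toℕ a) τ
    Avᵣ-insert-≥ h≤a with Avᵣ-map (punchIn a) (punchIn-mono-< a) (punchIn-≺-≤ a ℕ.≤-refl) τ
    ... | eq rewrite ℕ.m≤n⇒m⊔n≡n h≤a = mk⇔
      (to eq ∘ proj₂)
      (λ av → (λ a<h → contradiction h≤a (ℕ.<⇒≱ a<h)) , from eq av)

    lrmᵣ-insert-≥ : ∀ {h} → h ≤ toℕ a → lrmᵣ h (insert a τ) ≡ suc (lrmᵣ (toℕ a) τ)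
    lrmᵣ-insert-≥ {h} h≤a rewrite dec-false (a ≺? h) (ℕ.≤⇒≯ h≤a) | ℕ.m≤n⇒m⊔n≡n (ℕ.m≤n⇒m≤1+n h≤a) =
      cong suc (lrmᵣ-map (punchIn a) (punchIn-mono-< a) (punchIn-≺-≥ a ℕ.≤-refl) τ)

    below-insert-≥ : ∀ {p} → p ≤ toℕ a → below p (insert a τ) ≡ below p τ
    below-insert-≥ {p} p≤a rewrite dec-false (a ≺? p) (ℕ.≤⇒≯ p≤a) =
      below-map (punchIn a) (punchIn-mono-< a) (punchIn-≺-≤ a p≤a) τ

    below-insert-< : ∀ {p} → toℕ a ≤ p → below (suc p) (insert a τ) ≡ suc (below p τ)
    below-insert-< {p} a≤p rewrite dec-true (a ≺? suc p) (s≤s a≤p) =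
      cong suc (below-map (punchIn a) (punchIn-mono-< a) (punchIn-≺-≥ a a≤p) τ)

  module _ (h : ℕ) (τ : Vec (Fin n) m) where

    Avᵣ-insert-0 : Avᵣ (suc h) (insert Fin.zero τ) ⇔ Avᵣ h τ
    Avᵣ-insert-0 with Avᵣ-map (punchIn Fin.zero) (punchIn-mono-< Fin.zero) (punchIn-≺-≥ {p = h} Fin.zero z≤n) τ
    ... | eq = mk⇔ (to eq ∘ proj₂) (λ av → (λ _ → All.universal (λ _ ()) _) , from eq av)

    lrmᵣ-insert-0 : lrmᵣ (suc h) (insert Fin.zero τ) ≡ lrmᵣ h τ
    lrmᵣ-insert-0 rewrite ℕ.⊔-identityʳ h =
      lrmᵣ-map (punchIn Fin.zero) (punchIn-mono-< Fin.zero) (punchIn-≺-≥ Fin.zero z≤n) τ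

  below-none : ∀ {p} {v : Vec (Fin N) m} → All (λ b → ¬ b ≺ p) v → below p v ≡ 0
  below-none             []                          = refl
  below-none {p = p} {v = b ∷ _} (b≮p ∷ ≮s) rewrite dec-false (b ≺? p) b≮p = below-none ≮s

  -- The hypothesis on `below` provides a smaller letter behind `a`; with `a` below the maximum this
  -- is the forbidden 21.
  Avᵣ-insert-< : ∀ {h} (a : Fin (suc n)) (τ : Vec (Fin n) m) →
    below (toℕ a) τ ≢ 0 → toℕ a < h → ¬ Avᵣ h (insert a τ)
  Avᵣ-insert-< a τ below≢0 a<h (f , _) = below≢0 (trans
    (sym (below-map (punchIn a) (punchIn-mono-< a) (punchIn-≺-≤ a ℕ.≤-refl) τ))
    (below-none (f a<h)))

  -- The one fact about permutations that the recursion draws on. It counts the inversions made by a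
  -- new first letter `a`, and for `a` other than zero it guarantees a smaller letter behind `a`.
  below-𝔖 : ∀ n → ListAll.All (λ τ → ∀ p → p ≤ n → below p τ ≡ p) (𝔖 n)
  below-𝔖 zero    = (λ { .0 z≤n → refl }) ListAll.∷ ListAll.[]
  below-𝔖 (suc n) rewrite 𝔖-suc n = ListAll.cartesianProductWith⁺ (setoid _) (setoid _) insert (allFin (suc n)) (𝔖 n)
    λ {a} {τ} _ τ∈ → helper a τ (ListAll.lookup (below-𝔖 n) τ∈)
    where
    helper : ∀ a (τ : Word n) → (∀ p → p ≤ n → below p τ ≡ p) → ∀ p → p ≤ suc n → below p (insert a τ) ≡ p
    helper a τ ih p p≤ with p ℕ.≤? toℕ a
    ... | yes p≤a = trans (below-insert-≥ a τ p≤a) (ih p (ℕ.≤-trans p≤a (Fin.toℕ≤pred[n] a)))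
    helper a τ ih zero    p≤ | no p≰a = contradiction z≤n p≰a
    helper a τ ih (suc p) p≤ | no p≰a = trans (below-insert-< a τ (s≤s⁻¹ (ℕ.≰⇒> p≰a))) (cong suc (ih p (s≤s⁻¹ p≤)))

open Permutations

-- Finite sums in a commutative ring.

module Sums {c ℓ} (R : CommutativeRing c ℓ) where

  private variable
    a p : Level
    A B D : Set a

  open CommutativeRing R hiding (_-_)
  open RingNotation rawRing using (∑)
  open CommutativeSemigroupProperties +-commutativeSemigroup using (interchange)
  open ≈-Reasoning setoid

  ∑-cong-All : {f g : A → Carrier} {xs : List A} → ListAll.All (λ x → f x ≈ g x) xs → ∑ xs f ≈ ∑ xs g
  ∑-cong-All ListAll.[]           = refl
  ∑-cong-All (eq ListAll.∷ eqs) = +-cong eq (∑-cong-All eqs)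

  ∑-cong : {f g : A → Carrier} (xs : List A) → (∀ x → f x ≈ g x) → ∑ xs f ≈ ∑ xs g
  ∑-cong xs eq = ∑-cong-All (ListAll.universal eq xs)

  ∑-0 : (xs : List A) → ∑[ _ ∈ xs ] 0# ≈ 0#
  ∑-0 []       = refl
  ∑-0 (x ∷ xs) = trans (+-identityˡ _) (∑-0 xs)

  ∑-distribˡ : ∀ r (xs : List A) (f : A → Carrier) → r * ∑ xs f ≈ ∑[ x ∈ xs ] r * f x
  ∑-distribˡ r []       f = zeroʳ r
  ∑-distribˡ r (x ∷ xs) f = trans (distribˡ r _ _) (+-congˡ (∑-distribˡ r xs f))

  ∑-++ : ∀ (xs ys : List A) (f : A → Carrier) → ∑ (xs ++ ys) f ≈ ∑ xs f + ∑ ys f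
  ∑-++ []       ys f = sym (+-identityˡ _)
  ∑-++ (x ∷ xs) ys f = trans (+-congˡ (∑-++ xs ys f)) (sym (+-assoc _ _ _))

  ∑-map : ∀ (g : B → A) xs (f : A → Carrier) → ∑ (List.map g xs) f ≡ ∑ xs (f ∘ g)
  ∑-map g xs f = ≡.cong (List.foldr _+_ 0#) (≡.sym (List.map-∘ xs))

  ∑-cartesianProductWith : ∀ (g : A → B → D) as bs (f : D → Carrier) →
    ∑ (List.cartesianProductWith g as bs) f ≈ ∑[ a ∈ as ] ∑[ b ∈ bs ] f (g a b)
  ∑-cartesianProductWith g []       bs f = refl
  ∑-cartesianProductWith g (a ∷ as) bs f = trans
    (∑-++ (List.map (g a) bs) _ f)
    (+-cong (reflexive (∑-map (g a) bs f)) (∑-cartesianProductWith g as bs f))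

  ∑-filter : {P : Pred A p} (P? : Decidable P) (xs : List A) (f : A → Carrier) →
    ∑ (List.filter P? xs) f ≈ ∑[ x ∈ xs ] (if does (P? x) then f x else 0#)
  ∑-filter P? []       f = refl
  ∑-filter P? (x ∷ xs) f with does (P? x)
  ... | true  = +-congˡ (∑-filter P? xs f)
  ... | false = trans (∑-filter P? xs f) (sym (+-identityˡ _))

  ∑-allFin : ∀ n (f : Fin (suc n) → Carrier) → ∑ (allFin (suc n)) f ≡ f Fin.zero + ∑ (allFin n) (f ∘ Fin.suc)
  ∑-allFin n f = ≡.cong (f Fin.zero +_) (≡.trans (≡.cong (λ is → ∑ is f) (tabulate-suc n)) (∑-map Fin.suc (allFin n) f))

  -- The indices below `h` stay in the range with zero terms, so that the sum can be compared term
  -- by term with a sum over all first letters.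
  ∑-from : ℕ → ℕ → (ℕ → Carrier) → Carrier
  ∑-from n h f = ∑[ i ∈ allFin n ] (if does (i ≺? h) then 0# else f (toℕ i))

  ∑-from-suc : ∀ {n h} → h < n → ∀ f → ∑-from n h f ≈ f h + ∑-from n (suc h) f
  ∑-from-suc {suc n} {zero}  _   f = begin
    ∑-from (suc n) 0 f                          ≡⟨ ∑-allFin n (λ i → f (toℕ i)) ⟩
    f 0 + ∑-from n 0 (f ∘ suc)                  ≈⟨ +-congˡ (+-identityˡ _) ⟨
    f 0 + (0# + ∑-from n 0 (f ∘ suc))
      ≡⟨ ≡.cong (f 0 +_) (∑-allFin n (λ i → if does (i ≺? 1) then 0# else f (toℕ i))) ⟨
    f 0 + ∑-from (suc n) 1 f                    ∎
  ∑-from-suc {suc n} {suc h} h<n f = begin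
    ∑-from (suc n) (suc h) f
      ≡⟨ ∑-allFin n (λ i → if does (i ≺? suc h) then 0# else f (toℕ i)) ⟩
    0# + ∑-from n h (f ∘ suc)                   ≈⟨ +-identityˡ _ ⟩
    ∑-from n h (f ∘ suc)                        ≈⟨ ∑-from-suc (s<s⁻¹ h<n) (f ∘ suc) ⟩
    f (suc h) + ∑-from n (suc h) (f ∘ suc)      ≈⟨ +-congˡ (+-identityˡ _) ⟨
    f (suc h) + (0# + ∑-from n (suc h) (f ∘ suc))
      ≡⟨ ≡.cong (f (suc h) +_) (∑-allFin n (λ i → if does (i ≺? suc (suc h)) then 0# else f (toℕ i))) ⟨
    f (suc h) + ∑-from (suc n) (suc (suc h)) f  ∎

  ∑-from-end : ∀ n f → ∑-from n n f ≈ 0#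
  ∑-from-end n f = trans (∑-cong (allFin n) λ i →
    reflexive (≡.cong (λ d → if d then 0# else f (toℕ i)) (dec-true (i ≺? n) (Fin.toℕ<n i)))) (∑-0 (allFin n))

  Σ< : ℕ → (ℕ → Carrier) → Carrier
  Σ< zero    f = 0#
  Σ< (suc n) f = f 0 + Σ< n (f ∘ suc)

  Σ<-cong : ∀ n {f g : ℕ → Carrier} → (∀ i → i < n → f i ≈ g i) → Σ< n f ≈ Σ< n g
  Σ<-cong zero    eq = refl
  Σ<-cong (suc n) eq = +-cong (eq 0 z<s) (Σ<-cong n λ i i<n → eq (suc i) (s<s i<n))

  Σ<-0 : ∀ n → Σ< n (λ _ → 0#) ≈ 0#
  Σ<-0 zero    = refl
  Σ<-0 (suc n) = trans (+-identityˡ _) (Σ<-0 n)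

  Σ<-distribˡ : ∀ r n f → r * Σ< n f ≈ Σ< n (λ i → r * f i)
  Σ<-distribˡ r zero    f = zeroʳ r
  Σ<-distribˡ r (suc n) f = trans (distribˡ r _ _) (+-congˡ (Σ<-distribˡ r n (f ∘ suc)))

  Σ<-distrib-+ : ∀ n f g → Σ< n (λ i → f i + g i) ≈ Σ< n f + Σ< n g
  Σ<-distrib-+ zero    f g = sym (+-identityˡ _)
  Σ<-distrib-+ (suc n) f g = trans (+-congˡ (Σ<-distrib-+ n (f ∘ suc) (g ∘ suc))) (interchange _ _ _ _)

  Σ<-last : ∀ n f → Σ< (suc n) f ≈ Σ< n f + f n
  Σ<-last zero    f = +-comm _ _
  Σ<-last (suc n) f = trans (+-congˡ (Σ<-last n (f ∘ suc))) (sym (+-assoc _ _ _))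

  Σ<-pairs : ∀ n f → Σ< (n ℕ.* 2) f ≈ Σ< n (λ i → f (i ℕ.* 2) + f (suc (i ℕ.* 2)))
  Σ<-pairs zero    f = refl
  Σ<-pairs (suc n) f = trans (+-congˡ (+-congˡ (Σ<-pairs n (f ∘ suc ∘ suc)))) (sym (+-assoc _ _ _))

  ∑-applyUpTo : ∀ (g : ℕ → ℕ) n f → ∑ (List.applyUpTo g n) f ≡ Σ< n (f ∘ g)
  ∑-applyUpTo g zero    f = ≡.refl
  ∑-applyUpTo g (suc n) f = ≡.cong (f (g 0) +_) (∑-applyUpTo (g ∘ suc) n f)

-- The recursion for F, for arbitrary q and t.

module Enumeration {c ℓ} (R : CommutativeRing c ℓ) (q t : CommutativeRing.Carrier R) where

  open CommutativeRing R hiding (_-_)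
  open RingNotation rawRing using (∑; _^_)
  open Exp semiring using (^-homo-*)
  open Sums R
  open CommutativeSemigroupProperties *-commutativeSemigroup using (x∙yz≈y∙xz)
  open ≈-Reasoning setoid

  weight : ∀ {n} → ℕ → Word n → Carrier
  weight h τ = if does (avᵣ? h τ) then q ^ invᵣ τ * t ^ lrmᵣ h τ else 0#

  F : ℕ → ℕ → Carrier
  F n h = ∑[ τ ∈ 𝔖 n ] weight h τ

  F-pred : ℕ → ℕ → Carrier
  F-pred n zero    = 0#
  F-pred n (suc h) = F n h

  tF : ℕ → ℕ → Carrier
  tF n a = (t * q ^ a) * F n a

  module _ {n} (a : Fin (suc n)) (τ : Word n) (below≡ : ∀ p → p ≤ n → below p τ ≡ p) where

    a≤n : toℕ a ≤ n
    a≤n = Fin.toℕ≤pred[n] a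

    weight-insert-≥ : ∀ {h} → h ≤ toℕ a → weight h (insert a τ) ≈ (t * q ^ toℕ a) * weight (toℕ a) τ
    weight-insert-≥ {h} h≤a
      rewrite does-⇔ (Avᵣ-insert-≥ a τ h≤a) (avᵣ? h (insert a τ)) (avᵣ? (toℕ a) τ)
            | lrmᵣ-insert-≥ a τ h≤a | invᵣ-insert a τ | below≡ (toℕ a) a≤n
      with does (avᵣ? (toℕ a) τ)
    ... | false = sym (zeroʳ _)
    ... | true  = begin
      q ^ (toℕ a ℕ.+ invᵣ τ) * (t * t ^ lrmᵣ (toℕ a) τ)
        ≈⟨ *-congʳ (^-homo-* q (toℕ a) (invᵣ τ)) ⟩
      (q ^ toℕ a * q ^ invᵣ τ) * (t * t ^ lrmᵣ (toℕ a) τ)    ≈⟨ x∙yz≈y∙xz _ t _ ⟩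
      t * ((q ^ toℕ a * q ^ invᵣ τ) * t ^ lrmᵣ (toℕ a) τ)    ≈⟨ *-congˡ (*-assoc _ _ _) ⟩
      t * (q ^ toℕ a * (q ^ invᵣ τ * t ^ lrmᵣ (toℕ a) τ))    ≈⟨ *-assoc _ _ _ ⟨
      (t * q ^ toℕ a) * (q ^ invᵣ τ * t ^ lrmᵣ (toℕ a) τ)    ∎

    weight-insert-< : ∀ {h} → toℕ a ≢ 0 → toℕ a < h → weight h (insert a τ) ≈ 0#
    weight-insert-< {h} a≢0 a<h
      rewrite dec-false (avᵣ? h (insert a τ)) (Avᵣ-insert-< a τ (a≢0 ∘ ≡.trans (≡.sym (below≡ (toℕ a) a≤n))) a<h)
      = refl

  weight-insert-0 : ∀ {n} h (τ : Word n) → (∀ p → p ≤ n → below p τ ≡ p) →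
    weight (suc h) (insert Fin.zero τ) ≈ weight h τ
  weight-insert-0 h τ below≡
    rewrite does-⇔ (Avᵣ-insert-0 h τ) (avᵣ? (suc h) (insert Fin.zero τ)) (avᵣ? h τ)
          | lrmᵣ-insert-0 h τ | invᵣ-insert Fin.zero τ | below≡ 0 z≤n
    = refl

  F-suc : ∀ n h → F (suc n) h ≈ F-pred n h + ∑-from (suc n) h (tF n)
  F-suc n h = begin
    ∑ (𝔖 (suc n)) (weight h)
      ≡⟨ ≡.cong (λ σs → ∑ σs (weight h)) (𝔖-suc n) ⟩
    ∑ (List.cartesianProductWith insert (allFin (suc n)) (𝔖 n)) (weight h)
      ≈⟨ ∑-cartesianProductWith insert (allFin (suc n)) (𝔖 n) (weight h) ⟩
    ∑[ a ∈ allFin (suc n) ] ∑[ τ ∈ 𝔖 n ] weight h (insert a τ)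
      ≈⟨ by-first-letter h ⟩
    F-pred n h + ∑-from (suc n) h (tF n) ∎
    where
    from-≥ : ∀ {h} a → h ≤ toℕ a → ∑[ τ ∈ 𝔖 n ] weight h (insert a τ) ≈ tF n (toℕ a)
    from-≥ a h≤a = trans
      (∑-cong-All (ListAll.map (λ {τ} below≡ → weight-insert-≥ a τ below≡ h≤a) (below-𝔖 n)))
      (sym (∑-distribˡ _ (𝔖 n) (weight (toℕ a))))

    by-first-letter : ∀ h → ∑[ a ∈ allFin (suc n) ] ∑[ τ ∈ 𝔖 n ] weight h (insert a τ)
                          ≈ F-pred n h + ∑-from (suc n) h (tF n)
    by-first-letter zero    = trans (∑-cong (allFin (suc n)) (λ a → from-≥ a z≤n)) (sym (+-identityˡ _))
    by-first-letter (suc h) = begin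
      ∑[ a ∈ allFin (suc n) ] ∑[ τ ∈ 𝔖 n ] weight (suc h) (insert a τ)
        ≡⟨ ∑-allFin n (λ a → ∑[ τ ∈ 𝔖 n ] weight (suc h) (insert a τ)) ⟩
      (∑[ τ ∈ 𝔖 n ] weight (suc h) (insert Fin.zero τ))
        + (∑[ a ∈ allFin n ] ∑[ τ ∈ 𝔖 n ] weight (suc h) (insert (Fin.suc a) τ))
        ≈⟨ +-cong (∑-cong-All (ListAll.map (λ {τ} → weight-insert-0 h τ) (below-𝔖 n))) (begin
             (∑[ a ∈ allFin n ] ∑[ τ ∈ 𝔖 n ] weight (suc h) (insert (Fin.suc a) τ))
               ≈⟨ ∑-cong (allFin n) from-suc ⟩
             (∑[ a ∈ allFin n ] (if does (a ≺? h) then 0# else tF n (suc (toℕ a))))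
               ≈⟨ +-identityˡ _ ⟨
             0# + (∑[ a ∈ allFin n ] (if does (a ≺? h) then 0# else tF n (suc (toℕ a))))
               ≡⟨ ∑-allFin n (λ a → if does (a ≺? suc h) then 0# else tF n (toℕ a)) ⟨
             ∑-from (suc n) (suc h) (tF n) ∎) ⟩
      F n h + ∑-from (suc n) (suc h) (tF n) ∎
      where
      -- The letters 1, ..., `h` lie below the maximum but leave the letter 0 behind them, so they
      -- contribute nothing.
      from-suc : ∀ a → ∑[ τ ∈ 𝔖 n ] weight (suc h) (insert (Fin.suc a) τ)
                     ≈ (if does (a ≺? h) then 0# else tF n (suc (toℕ a)))
      from-suc a with a ≺? h
      ... | yes a<h = trans
        (trans (∑-cong-All (ListAll.map
                 (λ {τ} below≡ → weight-insert-< (Fin.suc a) τ below≡ (λ ()) (s<s a<h)) (below-𝔖 n)))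
               (∑-0 (𝔖 n)))
        (reflexive (≡.cong (λ d → if d then 0# else tF n (suc (toℕ a))) (≡.sym (dec-true (a ≺? h) a<h))))
      ... | no a≮h = trans
        (from-≥ (Fin.suc a) (ℕ.≮⇒≥ (a≮h ∘ s<s⁻¹)))
        (reflexive (≡.cong (λ d → if d then 0# else tF n (suc (toℕ a))) (≡.sym (dec-false (a ≺? h) a≮h))))

  ∑-Av321 : ∀ n → ∑[ σ ∈ Av321 n ] (q ^ inv σ * t ^ lrm σ) ≈ F n 0
  ∑-Av321 n = trans (∑-filter avoids321? (𝔖 n) (λ σ → q ^ inv σ * t ^ lrm σ)) (∑-cong (𝔖 n) pointwise)
    where
    pointwise : ∀ σ → (if does (avoids321? σ) then q ^ inv σ * t ^ lrm σ else 0#) ≈ weight 0 σ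
    pointwise σ
      rewrite does-⇔ (avoids321⇔Avᵣ σ) (avoids321? σ) (avᵣ? 0 σ) | inv≡invᵣ σ | lrm≡lrmᵣ σ = refl

-- Parities, absorption for binomial coefficients, and halves.

data Parity : ℕ → Set where
  even : ∀ m → Parity (m ℕ.* 2)
  odd  : ∀ m → Parity (suc (m ℕ.* 2))

parity : ∀ n → Parity n
parity zero    = even zero
parity (suc n) with parity n
... | even m = odd m
... | odd  m = even (suc m)

[k+1]*[n+1]C[k+1]≡[n+1]*nCk : ∀ n k → suc k ℕ.* (suc n C suc k) ≡ suc n ℕ.* (n C k)
[k+1]*[n+1]C[k+1]≡[n+1]*nCk zero    zero    = ≡.refl
[k+1]*[n+1]C[k+1]≡[n+1]*nCk zero    (suc k) = ℕ.*-zeroʳ (suc (suc k))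
[k+1]*[n+1]C[k+1]≡[n+1]*nCk (suc n) zero    =
  ≡.trans (ℕ.*-identityˡ _) (≡.trans (nC1≡n (suc (suc n))) (≡.sym (ℕ.*-identityʳ _)))
[k+1]*[n+1]C[k+1]≡[n+1]*nCk (suc n) (suc k) = begin
  suc (suc k) ℕ.* (suc (suc n) C suc (suc k))
    ≡⟨ ≡.cong (suc (suc k) ℕ.*_) (nCk+nC[k+1]≡[n+1]C[k+1] (suc n) (suc k)) ⟨
  suc (suc k) ℕ.* (p ℕ.+ (suc n C suc (suc k)))
    ≡⟨ ℕ.*-distribˡ-+ (suc (suc k)) p _ ⟩
  p ℕ.+ suc k ℕ.* p ℕ.+ suc (suc k) ℕ.* (suc n C suc (suc k))
    ≡⟨ ≡.cong₂ (λ x y → p ℕ.+ x ℕ.+ y)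
         ([k+1]*[n+1]C[k+1]≡[n+1]*nCk n k) ([k+1]*[n+1]C[k+1]≡[n+1]*nCk n (suc k)) ⟩
  p ℕ.+ suc n ℕ.* (n C k) ℕ.+ suc n ℕ.* (n C suc k)
    ≡⟨ ℕ.+-assoc p _ _ ⟩
  p ℕ.+ (suc n ℕ.* (n C k) ℕ.+ suc n ℕ.* (n C suc k))
    ≡⟨ ≡.cong (p ℕ.+_) (ℕ.*-distribˡ-+ (suc n) (n C k) (n C suc k)) ⟨
  p ℕ.+ suc n ℕ.* ((n C k) ℕ.+ (n C suc k))
    ≡⟨ ≡.cong (λ x → p ℕ.+ suc n ℕ.* x) (nCk+nC[k+1]≡[n+1]C[k+1] n k) ⟩
  suc (suc n) ℕ.* p ∎
  where
  open ≡.≡-Reasoning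
  p = suc n C suc k

⌊m*2/2⌋≡m : ∀ m → ⌊ m ℕ.* 2 /2⌋ ≡ m
⌊m*2/2⌋≡m zero    = ≡.refl
⌊m*2/2⌋≡m (suc m) = ≡.cong suc (⌊m*2/2⌋≡m m)

⌊1+m*2/2⌋≡m : ∀ m → ⌊ suc (m ℕ.* 2) /2⌋ ≡ m
⌊1+m*2/2⌋≡m zero    = ≡.refl
⌊1+m*2/2⌋≡m (suc m) = ≡.cong suc (⌊1+m*2/2⌋≡m m)

-- The recursion at q = -1 and its solution.

module ClosedForm {r ℓ} (R : CommutativeRing r ℓ)
  (ι : ℤ.+-*-rawRing -Raw-AlmostCommutative⟶ fromCommutativeRing R) where

  open CommutativeRing R hiding (_-_; zero)
  open RingNotation rawRing using (∑; _^_; _·_; _-_)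

  private
    module ι = _-Raw-AlmostCommutative⟶_ ι

    -- ι, adjusted so that the solver's constants con 0ℤ and con 1ℤ are definitionally 0# and 1#.
    ⟦_⟧ : ℤ.ℤ → Carrier
    ⟦ ℤ.+ 0 ⟧ = 0#
    ⟦ ℤ.+ 1 ⟧ = 1#
    ⟦ i     ⟧ = ι.⟦ i ⟧

    ⟦⟧≈ι : ∀ i → ⟦ i ⟧ ≈ ι.⟦ i ⟧
    ⟦⟧≈ι (ℤ.+ 0)             = sym ι.0-homo
    ⟦⟧≈ι (ℤ.+ 1)             = sym ι.1-homo
    ⟦⟧≈ι (ℤ.+ suc (suc _))   = refl
    ⟦⟧≈ι ℤ.-[1+ _ ]          = refl

    coefficients : ℤ.+-*-rawRing -Raw-AlmostCommutative⟶ fromCommutativeRing R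
    coefficients = record
      { ⟦_⟧    = ⟦_⟧
      ; +-homo = λ i j → trans (⟦⟧≈ι (i ℤ.+ j)) (trans (ι.+-homo i j) (sym (+-cong (⟦⟧≈ι i) (⟦⟧≈ι j))))
      ; *-homo = λ i j → trans (⟦⟧≈ι (i ℤ.* j)) (trans (ι.*-homo i j) (sym (*-cong (⟦⟧≈ι i) (⟦⟧≈ι j))))
      ; -‿homo = λ i → trans (⟦⟧≈ι (ℤ.- i)) (trans (ι.-‿homo i) (sym (-‿cong (⟦⟧≈ι i))))
      ; 0-homo = refl
      ; 1-homo = refl
      }

  open RingSolver ℤ.+-*-rawRing (fromCommutativeRing R) coefficients
    (λ i j → Maybe.map (reflexive ∘ ≡.cong ⟦_⟧) (dec⇒maybe (i ℤ.≟ j)))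
    using (solve; con; _:=_; _:+_; _:*_; _:-_; :-_)

  open Exp semiring using (^-homo-*)
  open Mult semiring using (×-homo-+; ×-assoc-*; ×-comm-*; ×-congˡ; ×-congʳ; ×-assocˡ)
  open Sums R
  open ≈-Reasoning setoid

  σ : ℕ → Carrier
  σ n = (- 1#) ^ n

  σ-+2 : ∀ n → σ (suc (suc n)) ≈ σ n
  σ-+2 n = solve 1 (λ y → (:- con ℤ.1ℤ) :* ((:- con ℤ.1ℤ) :* y) := y) refl (σ n)

  σ-even : ∀ m → σ (m ℕ.* 2) ≈ 1#
  σ-even zero    = refl
  σ-even (suc m) = trans (σ-+2 (m ℕ.* 2)) (σ-even m)

  σ-odd : ∀ m → σ (suc (m ℕ.* 2)) ≈ - 1#
  σ-odd m = trans (*-congˡ (σ-even m)) (*-identityʳ (- 1#))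

  σ² : ∀ n → σ n * σ n ≈ 1#
  σ² zero    = *-identityˡ 1#
  σ² (suc n) = trans
    (solve 1 (λ y → ((:- con ℤ.1ℤ) :* y) :* ((:- con ℤ.1ℤ) :* y) := y :* y) refl (σ n))
    (σ² n)

  -- Expresses a sign at `n` through signs at `n + e` and `e`. It rewrites the power of q at `h` in
  -- the coordinates n = h + e and `e` of `c`, and later splits the sign of the closed form into a
  -- factor for n and one for k.
  σ-+-cancel : ∀ n e → σ (n ℕ.+ e) * σ e ≈ σ n
  σ-+-cancel n e = begin
    σ (n ℕ.+ e) * σ e  ≈⟨ *-congʳ (^-homo-* (- 1#) n e) ⟩
    σ n * σ e * σ e    ≈⟨ *-assoc _ _ _ ⟩
    σ n * (σ e * σ e)  ≈⟨ *-congˡ (σ² e) ⟩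
    σ n * 1#           ≈⟨ *-identityʳ _ ⟩
    σ n                ∎

  module _ (t : Carrier) where

    x : Carrier
    x = t * t

    open Enumeration R (- 1#) t

    -- For e ≤ n, c n e is F n (n - e) and t * w n e is the part of F (n + 1) (n - e) with
    -- first letter at least n - e.  The other values of c are chosen so that c n (n + 1) is 0
    -- and the formulas of EvenRow and OddRow hold for all e.
    c w : ℕ → ℕ → Carrier
    c zero    0 = 1#
    c zero    1 = 0#
    c zero    2 = - t
    c zero    (suc (suc e@(suc _))) = c zero e
    c (suc n) zero    = c n zero
    c (suc n) (suc e) = c n (suc e) + t * w n e
    w n zero    = σ n * σ 0 * c n zero
    w n (suc e) = σ n * σ (suc e) * c n (suc e) + w n e

    c-zeroʳ : ∀ n → c n 0 ≈ 1#
    c-zeroʳ zero    = refl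
    c-zeroʳ (suc n) = c-zeroʳ n

    module _ (c-vanishes : ∀ n → c n (suc n) ≈ 0#) where

      -- Since `c` and `w` are defined without `F`, the vanishing assumed here can be proved
      -- afterwards from the explicit rows, without circularity.
      F≈c    : ∀ n h e → h ℕ.+ e ≡ n → F n h ≈ c n e
      from≈w : ∀ n h e → h ℕ.+ e ≡ n → ∑-from (suc n) h (tF n) ≈ t * w n e

      F≈c zero zero zero ≡.refl = trans (+-identityʳ _) (*-identityˡ 1#)
      F≈c (suc n) zero (suc e) ≡.refl = begin
        F (suc n) 0                      ≈⟨ F-suc n 0 ⟩
        0# + ∑-from (suc n) 0 (tF n)     ≈⟨ +-cong (sym (c-vanishes n)) (from≈w n 0 n ≡.refl) ⟩
        c (suc n) (suc n)                ∎
      F≈c (suc n) (suc h) zero h+0≡n with ℕ.suc-injective (≡.trans (≡.sym (ℕ.+-identityʳ (suc h))) h+0≡n)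
      ... | ≡.refl = begin
        F (suc n) (suc n)                     ≈⟨ F-suc n (suc n) ⟩
        F n n + ∑-from (suc n) (suc n) (tF n) ≈⟨ +-congˡ (∑-from-end (suc n) (tF n)) ⟩
        F n n + 0#                            ≈⟨ +-identityʳ _ ⟩
        F n n                                 ≈⟨ F≈c n n 0 (ℕ.+-identityʳ n) ⟩
        c n 0                                 ∎
      F≈c (suc n) (suc h) (suc e) h+e≡n = begin
        F (suc n) (suc h)                     ≈⟨ F-suc n (suc h) ⟩
        F n h + ∑-from (suc n) (suc h) (tF n)
          ≈⟨ +-cong (F≈c n h (suc e) h+e≡) (from≈w n (suc h) e (≡.trans (≡.sym (ℕ.+-suc h e)) h+e≡)) ⟩
        c (suc n) (suc e)                     ∎
        where
        h+e≡ : h ℕ.+ suc e ≡ n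
        h+e≡ = ℕ.suc-injective h+e≡n

      from≈w n h zero h+0≡n with ≡.trans (≡.sym (ℕ.+-identityʳ h)) h+0≡n
      ... | ≡.refl = begin
        ∑-from (suc n) n (tF n)                ≈⟨ ∑-from-suc ℕ.≤-refl (tF n) ⟩
        tF n n + ∑-from (suc n) (suc n) (tF n)
          ≈⟨ +-cong (*-congˡ (F≈c n n 0 (ℕ.+-identityʳ n))) (∑-from-end (suc n) (tF n)) ⟩
        t * σ n * c n 0 + 0#
          ≈⟨ trans (+-identityʳ _) (solve 3 (λ t s c → t :* s :* c := t :* (s :* con ℤ.1ℤ :* c)) refl t (σ n) (c n 0)) ⟩
        t * (σ n * σ 0 * c n 0)                ∎
      from≈w n h (suc e) ≡.refl = begin
        ∑-from (suc n) h (tF n)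
          ≈⟨ ∑-from-suc (s≤s (ℕ.m≤m+n h (suc e))) (tF n) ⟩
        tF n h + ∑-from (suc n) (suc h) (tF n)
          ≈⟨ +-cong (*-cong (*-congˡ (sym (σ-+-cancel h (suc e)))) (F≈c n h (suc e) ≡.refl))
                    (from≈w n (suc h) e (≡.sym (ℕ.+-suc h e))) ⟩
        t * (σ n * σ (suc e)) * c n (suc e) + t * w n e
          ≈⟨ solve 4 (λ t s c w → t :* s :* c :+ t :* w := t :* (s :* c :+ w)) refl t _ (c n (suc e)) (w n e) ⟩
        t * w n (suc e) ∎

    -- G (1 + s) a b is Gₛ(a, b): the index is shifted to allow s = -1.
    G : ℕ → ℕ → ℕ → Carrier
    G s       (suc a) b = G s a b + x * G (suc s) a b
    G zero    zero    b = 0#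
    G (suc s) zero    b = (b C s) · 1#

    -- Multiplication of (1 + x/y)ᵃ (1 + y)ᵇ by 1 + y, whereas the defining clause for `suc a`
    -- multiplies by 1 + x/y.
    G-sucʳ : ∀ s a b → G (suc s) a (suc b) ≈ G (suc s) a b + G s a b
    G-sucʳ zero    zero    b = sym (+-identityʳ _)
    G-sucʳ (suc s) zero    b = begin
      (suc b C suc s) · 1#               ≡⟨ ≡.cong (_· 1#) (nCk+nC[k+1]≡[n+1]C[k+1] b s) ⟨
      ((b C s) ℕ.+ (b C suc s)) · 1#     ≈⟨ ×-homo-+ 1# (b C s) (b C suc s) ⟩
      (b C s) · 1# + (b C suc s) · 1#    ≈⟨ +-comm _ _ ⟩
      (b C suc s) · 1# + (b C s) · 1#    ∎
    G-sucʳ s (suc a) b = trans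
      (+-cong (G-sucʳ s a b) (*-congˡ (G-sucʳ (suc s) a b)))
      (solve 4 (λ x g₀ g₁ g₂ → g₁ :+ g₀ :+ x :* (g₂ :+ g₁) := g₁ :+ x :* g₂ :+ (g₀ :+ x :* g₁))
        refl x (G s a b) (G (suc s) a b) (G (suc (suc s)) a b))

    G-zeroʳ : ∀ s a → G (suc (suc s)) a 0 ≈ 0#
    G-zeroʳ s zero    = refl
    G-zeroʳ s (suc a) = trans (+-cong (G-zeroʳ s a) (trans (*-congˡ (G-zeroʳ (suc s) a)) (zeroʳ x))) (+-identityˡ 0#)

    G₀-zeroʳ : ∀ a → G 1 a 0 ≈ 1#
    G₀-zeroʳ zero    = +-identityʳ 1#
    G₀-zeroʳ (suc a) = trans (+-cong (G₀-zeroʳ a) (trans (*-congˡ (G-zeroʳ 0 a)) (zeroʳ x))) (+-identityʳ 1#)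

    -- The substitution of x/y for y exchanges (1 + x/y)ᵃ and (1 + y)ᵃ and turns the coefficient of
    -- y into x times it at 1/y. The inductions are mutual because each Pascal step mixes
    -- neighbouring indices.
    G₋₁-sym : ∀ a b → G 0 a b ≈ x * G 2 b a
    G₀-sym  : ∀ a b → G 1 a b ≈ G 1 b a

    G₋₁-sym zero    b = sym (trans (*-congˡ (G-zeroʳ 0 b)) (zeroʳ x))
    G₋₁-sym (suc a) b = begin
      G 0 a b + x * G 1 a b          ≈⟨ +-cong (G₋₁-sym a b) (*-congˡ (G₀-sym a b)) ⟩
      x * G 2 b a + x * G 1 b a      ≈⟨ distribˡ x _ _ ⟨
      x * (G 2 b a + G 1 b a)        ≈⟨ *-congˡ (G-sucʳ 1 b a) ⟨
      x * G 2 b (suc a)              ∎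

    G₀-sym zero    b = trans (+-identityʳ 1#) (sym (G₀-zeroʳ b))
    G₀-sym (suc a) b = begin
      G 1 a b + x * G 2 a b          ≈⟨ +-cong (G₀-sym a b) (sym (G₋₁-sym b a)) ⟩
      G 1 b a + G 0 b a              ≈⟨ G-sucʳ 0 b a ⟨
      G 1 b (suc a)                  ∎

    -- Explicit rows of the recursion, by parity.

    V : ℕ → ℕ → Carrier
    V m d = G 1 m d - t * G 2 m d

    -- Here the sign in `w` is (-1)ᵉ and only even `e` contribute. The partial sums telescope: by
    -- `G-sucʳ`, the value in `c-even` is `V m (suc d) - V m d`.
    record EvenRow (m : ℕ) : Set ℓ where
      field
        c-odd  : ∀ d → c (m ℕ.* 2) (suc (d ℕ.* 2)) ≈ 0#
        c-even : ∀ d → c (m ℕ.* 2) (suc d ℕ.* 2) ≈ G 0 m d - t * G 1 m d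

      w-even : ∀ d → w (m ℕ.* 2) (d ℕ.* 2) ≈ V m d
      w-odd  : ∀ d → w (m ℕ.* 2) (suc (d ℕ.* 2)) ≈ V m d

      w-even zero    = begin
        σ (m ℕ.* 2) * σ 0 * c (m ℕ.* 2) 0  ≈⟨ *-cong (*-congʳ (σ-even m)) (c-zeroʳ (m ℕ.* 2)) ⟩
        1# * 1# * 1#
          ≈⟨ solve 1 (λ t → con ℤ.1ℤ :* con ℤ.1ℤ :* con ℤ.1ℤ := con ℤ.1ℤ :- t :* con ℤ.0ℤ) refl t ⟩
        1# - t * 0#
          ≈⟨ +-cong (sym (G₀-zeroʳ m)) (-‿cong (*-congˡ (sym (G-zeroʳ 0 m)))) ⟩
        V m 0                              ∎
      w-even (suc d) = begin
        σ (m ℕ.* 2) * σ (suc d ℕ.* 2) * c (m ℕ.* 2) (suc d ℕ.* 2) + w (m ℕ.* 2) (suc (d ℕ.* 2))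
          ≈⟨ +-cong (*-cong (*-cong (σ-even m) (σ-even (suc d))) (c-even d)) (w-odd d) ⟩
        1# * 1# * (G 0 m d - t * G 1 m d) + V m d
          ≈⟨ solve 4 (λ t g₀ g₁ g₂ → con ℤ.1ℤ :* con ℤ.1ℤ :* (g₀ :- t :* g₁) :+ (g₁ :- t :* g₂)
                                  := (g₁ :+ g₀) :- t :* (g₂ :+ g₁)) refl t (G 0 m d) (G 1 m d) (G 2 m d) ⟩
        (G 1 m d + G 0 m d) - t * (G 2 m d + G 1 m d)
          ≈⟨ +-cong (sym (G-sucʳ 0 m d)) (-‿cong (*-congˡ (sym (G-sucʳ 1 m d)))) ⟩
        V m (suc d) ∎

      w-odd d = begin
        σ (m ℕ.* 2) * σ (suc (d ℕ.* 2)) * c (m ℕ.* 2) (suc (d ℕ.* 2)) + w (m ℕ.* 2) (d ℕ.* 2)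
          ≈⟨ +-cong (trans (*-congˡ (c-odd d)) (zeroʳ _)) (w-even d) ⟩
        0# + V m d  ≈⟨ +-identityˡ _ ⟩
        V m d       ∎

    -- All signs in `w` are reversed and the odd entries no longer vanish, so `w` alternates between
    -- two values. The term -t² G₁ of `c-even` cancels against that of `t * V m d`, which makes the
    -- even partial sums telescope to `- V m d`.
    record OddRow (m : ℕ) : Set ℓ where
      field
        c-odd  : ∀ d → c (suc (m ℕ.* 2)) (suc (d ℕ.* 2)) ≈ t * V m d
        c-even : ∀ d → c (suc (m ℕ.* 2)) (suc d ℕ.* 2) ≈ G 0 m d - x * G 2 m d

      w-even : ∀ d → w (suc (m ℕ.* 2)) (d ℕ.* 2) ≈ - V m d
      w-odd  : ∀ d → w (suc (m ℕ.* 2)) (suc (d ℕ.* 2)) ≈ t * V m d - V m d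

      w-even zero    = begin
        σ (suc (m ℕ.* 2)) * σ 0 * c (m ℕ.* 2) 0  ≈⟨ *-cong (*-congʳ (σ-odd m)) (c-zeroʳ (m ℕ.* 2)) ⟩
        (- 1#) * 1# * 1#
          ≈⟨ solve 1 (λ t → (:- con ℤ.1ℤ) :* con ℤ.1ℤ :* con ℤ.1ℤ := :- (con ℤ.1ℤ :- t :* con ℤ.0ℤ)) refl t ⟩
        - (1# - t * 0#)
          ≈⟨ -‿cong (+-cong (sym (G₀-zeroʳ m)) (-‿cong (*-congˡ (sym (G-zeroʳ 0 m))))) ⟩
        - V m 0                                  ∎
      w-even (suc d) = begin
        σ (suc (m ℕ.* 2)) * σ (suc d ℕ.* 2) * c (suc (m ℕ.* 2)) (suc d ℕ.* 2) + w (suc (m ℕ.* 2)) (suc (d ℕ.* 2))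
          ≈⟨ +-cong (*-cong (*-cong (σ-odd m) (σ-even (suc d))) (c-even d)) (w-odd d) ⟩
        (- 1#) * 1# * (G 0 m d - x * G 2 m d) + (t * V m d - V m d)
          ≈⟨ solve 4 (λ t g₀ g₁ g₂ →
               (:- con ℤ.1ℤ) :* con ℤ.1ℤ :* (g₀ :- (t :* t) :* g₂) :+ (t :* (g₁ :- t :* g₂) :- (g₁ :- t :* g₂))
                 := :- ((g₁ :+ g₀) :- t :* (g₂ :+ g₁))) refl t (G 0 m d) (G 1 m d) (G 2 m d) ⟩
        - ((G 1 m d + G 0 m d) - t * (G 2 m d + G 1 m d))
          ≈⟨ -‿cong (+-cong (sym (G-sucʳ 0 m d)) (-‿cong (*-congˡ (sym (G-sucʳ 1 m d))))) ⟩
        - V m (suc d) ∎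

      w-odd d = begin
        σ (suc (m ℕ.* 2)) * σ (suc (d ℕ.* 2)) * c (suc (m ℕ.* 2)) (suc (d ℕ.* 2)) + w (suc (m ℕ.* 2)) (d ℕ.* 2)
          ≈⟨ +-cong (*-cong (*-cong (σ-odd m) (σ-odd d)) (c-odd d)) (w-even d) ⟩
        (- 1#) * (- 1#) * (t * V m d) - V m d
          ≈⟨ solve 2 (λ t v → (:- con ℤ.1ℤ) :* (:- con ℤ.1ℤ) :* (t :* v) :- v := t :* v :- v) refl t (V m d) ⟩
        t * V m d - V m d ∎

    evenRow⇒oddRow : ∀ {m} → EvenRow m → OddRow m
    evenRow⇒oddRow {m} E = record
      { c-odd  = λ d → trans (+-cong (E.c-odd d) (*-congˡ (E.w-even d))) (+-identityˡ _)
      ; c-even = λ d → trans (+-cong (E.c-even d) (*-congˡ (E.w-odd d)))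
          (solve 4 (λ t g₀ g₁ g₂ → (g₀ :- t :* g₁) :+ t :* (g₁ :- t :* g₂) := g₀ :- (t :* t) :* g₂)
            refl t (G 0 m d) (G 1 m d) (G 2 m d))
      }
      where module E = EvenRow E

    -- The odd entries cancel as `t * V m d - t * V m d`; the even ones assemble, by the defining
    -- clause of `G`, into those for `suc m`.
    oddRow⇒evenRow : ∀ {m} → OddRow m → EvenRow (suc m)
    oddRow⇒evenRow {m} O = record
      { c-odd  = λ d → trans (+-cong (O.c-odd d) (*-congˡ (O.w-even d)))
          (trans (+-congˡ (sym (-‿distribʳ-* t (V m d)))) (-‿inverseʳ (t * V m d)))
      ; c-even = λ d → trans (+-cong (O.c-even d) (*-congˡ (O.w-odd d)))
          (solve 4 (λ t g₀ g₁ g₂ →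
              (g₀ :- (t :* t) :* g₂) :+ t :* (t :* (g₁ :- t :* g₂) :- (g₁ :- t :* g₂))
                := (g₀ :+ (t :* t) :* g₁) :- t :* (g₁ :+ (t :* t) :* g₂))
            refl t (G 0 m d) (G 1 m d) (G 2 m d))
      }
      where
      module O = OddRow O
      open RingProperties ring using (-‿distribʳ-*)

    evenRow-0 : EvenRow 0
    evenRow-0 = record { c-odd = odd-values ; c-even = even-values }
      where
      odd-values : ∀ d → c 0 (suc (d ℕ.* 2)) ≈ 0#
      odd-values zero    = refl
      odd-values (suc d) = odd-values d

      even-values : ∀ d → c 0 (suc d ℕ.* 2) ≈ G 0 0 d - t * G 1 0 d
      even-values zero    = sym (trans (+-identityˡ _) (-‿cong (trans (*-congˡ (+-identityʳ 1#)) (*-identityʳ t))))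
      even-values (suc d) = even-values d

    evenRow : ∀ m → EvenRow m
    oddRow  : ∀ m → OddRow m
    evenRow zero    = evenRow-0
    evenRow (suc m) = oddRow⇒evenRow (oddRow m)
    oddRow m = evenRow⇒oddRow (evenRow m)

    -- For even `n` the index n + 1 is odd, where the row is zero throughout. For odd `n` the entry
    -- is G₋₁(m, m) - x G₁(m, m), zero by the symmetry on the diagonal.
    c-vanishes : ∀ n → c n (suc n) ≈ 0#
    c-vanishes n with parity n
    ... | even m = EvenRow.c-odd (evenRow m) m
    ... | odd  m = begin
      c (suc (m ℕ.* 2)) (suc m ℕ.* 2)  ≈⟨ OddRow.c-even (oddRow m) m ⟩
      G 0 m m - x * G 2 m m            ≈⟨ +-congʳ (G₋₁-sym m m) ⟩
      x * G 2 m m - x * G 2 m m        ≈⟨ -‿inverseʳ _ ⟩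
      0#                               ∎

    F-0 : ∀ n → F n 0 ≈ c n n
    F-0 n = F≈c c-vanishes n 0 n ≡.refl

    F-odd : ∀ m → F (suc (m ℕ.* 2)) 0 ≈ t * V m m
    F-odd m = trans (F-0 (suc (m ℕ.* 2))) (OddRow.c-odd (oddRow m) m)

    -- As `c` vanishes just past the diagonal, only the part starting with a left-right maximum
    -- remains, and the odd partial sum in the previous row already has the factor `t - 1`.
    F-even : ∀ m → F (suc m ℕ.* 2) 0 ≈ (t - 1#) * F (suc (m ℕ.* 2)) 0
    F-even m = begin
      F (suc m ℕ.* 2) 0
        ≈⟨ F-0 (suc m ℕ.* 2) ⟩
      c (suc (m ℕ.* 2)) (suc m ℕ.* 2) + t * w (suc (m ℕ.* 2)) (suc (m ℕ.* 2))
        ≈⟨ +-cong (c-vanishes (suc (m ℕ.* 2))) (*-congˡ (OddRow.w-odd (oddRow m) m)) ⟩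
      0# + t * (t * V m m - V m m)
        ≈⟨ solve 2 (λ t v → con ℤ.0ℤ :+ t :* (t :* v :- v) := (t :- con ℤ.1ℤ) :* (t :* v)) refl t (V m m) ⟩
      (t - 1#) * (t * V m m)
        ≈⟨ *-congˡ (F-odd m) ⟨
      (t - 1#) * F (suc (m ℕ.* 2)) 0 ∎

    -- Coefficients of Gₛ and the three-term recurrence.

    coeff-G : ℕ → ℕ → ℕ → ℕ → ℕ
    coeff-G s a b j = (a C j) ℕ.* (b C (s ℕ.+ j))

    -- Terms with j > a vanish, so the bound `N` is left free: in the induction the factor x shifts
    -- one of the sums by an index, and later two expansions have to share a range.
    G-explicit : ∀ s a b {N} → a < N → G (suc s) a b ≈ Σ< N (λ j → coeff-G s a b j · x ^ j)
    G-explicit s zero    b {suc N} _ = sym (begin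
      ((b C (s ℕ.+ 0)) ℕ.+ 0) · 1# + Σ< N (λ _ → 0#)
        ≈⟨ +-cong (reflexive (≡.cong (_· 1#) (≡.trans (ℕ.+-identityʳ _) (≡.cong (b C_) (ℕ.+-identityʳ s))))) (Σ<-0 N) ⟩
      (b C s) · 1# + 0#  ≈⟨ +-identityʳ _ ⟩
      (b C s) · 1#       ∎)
    G-explicit s (suc a) b {suc N} (s≤s a<N) = begin
      G (suc s) a b + x * G (suc (suc s)) a b
        ≈⟨ +-cong (G-explicit s a b (ℕ.m<n⇒m<1+n a<N)) (*-congˡ (G-explicit (suc s) a b a<N)) ⟩
      (coeff-G s a b 0 · 1# + Σ< N (λ j → coeff-G s a b (suc j) · x ^ suc j))
        + x * Σ< N (λ j → coeff-G (suc s) a b j · x ^ j)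
        ≈⟨ +-assoc _ _ _ ⟩
      coeff-G s a b 0 · 1#
        + (Σ< N (λ j → coeff-G s a b (suc j) · x ^ suc j) + x * Σ< N (λ j → coeff-G (suc s) a b j · x ^ j))
        ≈⟨ +-congˡ (+-congˡ (Σ<-distribˡ x N _)) ⟩
      coeff-G s a b 0 · 1#
        + (Σ< N (λ j → coeff-G s a b (suc j) · x ^ suc j) + Σ< N (λ j → x * coeff-G (suc s) a b j · x ^ j))
        ≈⟨ +-congˡ (Σ<-distrib-+ N _ _) ⟨
      coeff-G s a b 0 · 1# + Σ< N (λ j → coeff-G s a b (suc j) · x ^ suc j + x * coeff-G (suc s) a b j · x ^ j)
        ≈⟨ +-congˡ (Σ<-cong N λ j _ → pascal j) ⟩
      coeff-G s (suc a) b 0 · 1# + Σ< N (λ j → coeff-G s (suc a) b (suc j) · x ^ suc j) ∎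
      where
      pascal : ∀ j → coeff-G s a b (suc j) · x ^ suc j + x * coeff-G (suc s) a b j · x ^ j
                   ≈ coeff-G s (suc a) b (suc j) · x ^ suc j
      pascal j = begin
        coeff-G s a b (suc j) · x ^ suc j + x * coeff-G (suc s) a b j · x ^ j
          ≈⟨ +-congˡ (×-comm-* (coeff-G (suc s) a b j) x (x ^ j)) ⟩
        coeff-G s a b (suc j) · x ^ suc j + coeff-G (suc s) a b j · x ^ suc j
          ≈⟨ ×-homo-+ (x ^ suc j) (coeff-G s a b (suc j)) (coeff-G (suc s) a b j) ⟨
        (coeff-G s a b (suc j) ℕ.+ coeff-G (suc s) a b j) · x ^ suc j
          ≡⟨ ≡.cong (_· x ^ suc j) (≡.trans
               (≡.cong (λ k → coeff-G s a b (suc j) ℕ.+ (a C j) ℕ.* (b C k)) (≡.sym (ℕ.+-suc s j)))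
               (≡.trans (≡.sym (ℕ.*-distribʳ-+ (b C (s ℕ.+ suc j)) (a C suc j) (a C j)))
                 (≡.cong (ℕ._* (b C (s ℕ.+ suc j)))
                   (≡.trans (ℕ.+-comm (a C suc j) (a C j)) (nCk+nC[k+1]≡[n+1]C[k+1] a j))))) ⟩
        coeff-G s (suc a) b (suc j) · x ^ suc j ∎

    -- Termwise: (b + 1) C(b, j) C(a + 1, j + 1) equals (j + 1) C(b + 1, j + 1) C(a + 1, j + 1),
    -- which is symmetric in a and b.
    G-absorption : ∀ a b → suc b · G 2 b (suc a) ≈ suc a · G 2 a (suc b)
    G-absorption a b = begin
      suc b · G 2 b (suc a)
        ≈⟨ ·-explicit (suc b) b (suc a) (s≤s (ℕ.m≤n+m b a)) ⟩
      Σ< (suc (a ℕ.+ b)) (λ j → (suc b ℕ.* coeff-G 1 b (suc a) j) · x ^ j)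
        ≈⟨ Σ<-cong (suc (a ℕ.+ b)) (λ j _ → reflexive (≡.cong (_· x ^ j) (absorb j))) ⟩
      Σ< (suc (a ℕ.+ b)) (λ j → (suc a ℕ.* coeff-G 1 a (suc b) j) · x ^ j)
        ≈⟨ ·-explicit (suc a) a (suc b) (s≤s (ℕ.m≤m+n a b)) ⟨
      suc a · G 2 a (suc b) ∎
      where
      ·-Σ< : ∀ k N (f : ℕ → Carrier) → k · Σ< N f ≈ Σ< N (λ j → k · f j)
      ·-Σ< k N f = begin
        k · Σ< N f                  ≈⟨ ×-congʳ k (*-identityˡ _) ⟨
        k · (1# * Σ< N f)           ≈⟨ ×-assoc-* k 1# _ ⟨
        (k · 1#) * Σ< N f           ≈⟨ Σ<-distribˡ (k · 1#) N f ⟩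
        Σ< N (λ j → k · 1# * f j)
          ≈⟨ Σ<-cong N (λ j _ → trans (×-assoc-* k 1# (f j)) (×-congʳ k (*-identityˡ _))) ⟩
        Σ< N (λ j → k · f j)        ∎

      ·-explicit : ∀ k a b {N} → a < N → k · G 2 a b ≈ Σ< N (λ j → (k ℕ.* coeff-G 1 a b j) · x ^ j)
      ·-explicit k a b {N} a<N = trans (×-congʳ k (G-explicit 1 a b a<N))
        (trans (·-Σ< k N _) (Σ<-cong N λ j _ → ×-assocˡ (x ^ j) k (coeff-G 1 a b j)))

      absorb : ∀ j → suc b ℕ.* coeff-G 1 b (suc a) j ≡ suc a ℕ.* coeff-G 1 a (suc b) j
      absorb j = ≡.trans (move b (suc a C suc j)) (≡.trans
        (≡.cong (suc j ℕ.*_) (ℕ.*-comm (suc b C suc j) (suc a C suc j)))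
        (≡.sym (move a (suc b C suc j))))
        where
        move : ∀ n k → suc n ℕ.* ((n C j) ℕ.* k) ≡ suc j ℕ.* ((suc n C suc j) ℕ.* k)
        move n k = ≡.trans (≡.sym (ℕ.*-assoc (suc n) (n C j) k)) (≡.trans
          (≡.cong (ℕ._* k) (≡.sym ([k+1]*[n+1]C[k+1]≡[n+1]*nCk n j)))
          (ℕ.*-assoc (suc j) (suc n C suc j) k))

    -- `A m` is the Narayana polynomial of type B, with coefficients C(m, j)²; `B m` is m times the
    -- ordinary Narayana polynomial with constant term 1 when m ≥ 1.
    A B : ℕ → Carrier
    A m = G 1 m m
    B m = G 2 m m

    A-suc : ∀ m → A (suc m) ≈ A m + x * A m + (x * B m + x * B m)
    A-suc m = begin
      G 1 m (suc m) + x * G 2 m (suc m)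
        ≈⟨ +-cong (G-sucʳ 0 m m) (*-congˡ (G-sucʳ 1 m m)) ⟩
      A m + G 0 m m + x * (B m + A m)
        ≈⟨ +-congʳ (+-congˡ (G₋₁-sym m m)) ⟩
      A m + x * B m + x * (B m + A m)
        ≈⟨ solve 3 (λ x a b → a :+ x :* b :+ x :* (b :+ a) := a :+ x :* a :+ (x :* b :+ x :* b)) refl x (A m) (B m) ⟩
      A m + x * A m + (x * B m + x * B m) ∎

    -- Multiples written as products, so that the ring solver can treat the multiplier as a
    -- variable.
    ⟨_⟩ : ℕ → Carrier
    ⟨ n ⟩ = n · 1#

    ·-≈ : ∀ n y → n · y ≈ ⟨ n ⟩ * y
    ·-≈ n y = sym (trans (×-assoc-* n 1# y) (×-congʳ n (*-identityˡ y)))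

    -- Absorption trades the first argument m + 1 for m, at the price of m + 2 in the second;
    -- Pascal's rule in the second argument then leads back to the diagonal.
    B-suc : ∀ m → ⟨ suc (suc m) ⟩ * B (suc m) ≈ ⟨ suc m ⟩ * (A m + A m + (B m + x * B m))
    B-suc m = begin
      ⟨ suc (suc m) ⟩ * G 2 (suc m) (suc m)    ≈⟨ ·-≈ (suc (suc m)) _ ⟨
      suc (suc m) · G 2 (suc m) (suc m)        ≈⟨ G-absorption m (suc m) ⟩
      suc m · G 2 m (suc (suc m))              ≈⟨ ·-≈ (suc m) _ ⟩
      ⟨ suc m ⟩ * G 2 m (suc (suc m))          ≈⟨ *-congˡ (begin
        G 2 m (suc (suc m))
          ≈⟨ G-sucʳ 1 m (suc m) ⟩
        G 2 m (suc m) + G 1 m (suc m)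
          ≈⟨ +-cong (G-sucʳ 1 m m) (trans (G-sucʳ 0 m m) (+-congˡ (G₋₁-sym m m))) ⟩
        (B m + A m) + (A m + x * B m)
          ≈⟨ solve 3 (λ x a b → (b :+ a) :+ (a :+ x :* b) := a :+ a :+ (b :+ x :* b)) refl x (A m) (B m) ⟩
        A m + A m + (B m + x * B m) ∎) ⟩
      ⟨ suc m ⟩ * (A m + A m + (B m + x * B m)) ∎

    split-odd : ∀ k m → k · (t * V m m) ≈ ⟨ k ⟩ * t * A m - x * (⟨ k ⟩ * B m)
    split-odd k m = trans (·-≈ k _)
      (solve 4 (λ k t a b → k :* (t :* (a :- t :* b)) := k :* t :* a :- (t :* t) :* (k :* b)) refl ⟨ k ⟩ t (A m) (B m))

    V-recurrence-1 : 2 · (t * V 1 1) ≈ 2 · ((1 · (1# + t ^ 2) - t) * (t * V 0 0))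
    V-recurrence-1 = begin
      2 · (t * V 1 1)
        ≈⟨ split-odd 2 1 ⟩
      ⟨ 2 ⟩ * t * A 1 - x * (⟨ 2 ⟩ * B 1)
        ≈⟨ +-cong (*-congˡ (A-suc 0)) (-‿cong (*-congˡ (B-suc 0))) ⟩
      ⟨ 2 ⟩ * t * (A 0 + x * A 0 + (x * 0# + x * 0#)) - x * (⟨ 1 ⟩ * (A 0 + A 0 + (0# + x * 0#)))
        -- The solver terms follow the unfolding of `⟨ 1 ⟩`, `⟨ 2 ⟩` and `t ^ 2`, and `B 0` is
        -- definitionally `0#`. The identity is linear in `A 0`, which may stay a variable.
        ≈⟨ solve 2 (λ t a₀ →
             let b₀ = con ℤ.0ℤ
                 x  = t :* t
                 k₁ = con ℤ.1ℤ :+ con ℤ.0ℤ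
                 k₂ = con ℤ.1ℤ :+ k₁
             in k₂ :* t :* (a₀ :+ x :* a₀ :+ (x :* b₀ :+ x :* b₀)) :- x :* (k₁ :* (a₀ :+ a₀ :+ (b₀ :+ x :* b₀)))
                  := k₂ :* ((k₁ :* (con ℤ.1ℤ :+ t :* (t :* con ℤ.1ℤ)) :- t) :* (t :* (a₀ :- t :* b₀))))
           refl t (A 0) ⟩
      ⟨ 2 ⟩ * ((⟨ 1 ⟩ * (1# + t ^ 2) - t) * (t * V 0 0))
        ≈⟨ *-congˡ (*-congʳ (+-congʳ (·-≈ 1 _))) ⟨
      ⟨ 2 ⟩ * ((1 · (1# + t ^ 2) - t) * (t * V 0 0))
        ≈⟨ ·-≈ 2 _ ⟨
      2 · ((1 · (1# + t ^ 2) - t) * (t * V 0 0)) ∎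

    V-recurrence : ∀ l →
      suc (suc (suc l)) · (t * V (suc (suc l)) (suc (suc l)))
        ≈ 2 · ((suc (suc l) · (1# + t ^ 2) - t) * (t * V (suc l) (suc l)))
          - suc l · ((1# - t ^ 2) ^ 2 * (t * V l l))
    V-recurrence l = begin
      suc (suc (suc l)) · (t * V (suc (suc l)) (suc (suc l)))
        ≈⟨ split-odd (suc (suc (suc l))) (suc (suc l)) ⟩
      k₃ * t * A (suc (suc l)) - x * (k₃ * B (suc (suc l)))
        ≈⟨ +-cong (*-congˡ (A-suc (suc l))) (-‿cong (*-congˡ (B-suc (suc l)))) ⟩
      lhs (A (suc l))
        ≈⟨ +-cong (*-congˡ (+-congʳ (+-cong (A-suc l) (*-congˡ (A-suc l)))))
             (-‿cong (*-congˡ (*-congˡ (+-congʳ (+-cong (A-suc l) (A-suc l)))))) ⟩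
      lhs a₁
        -- `B (suc l)` could be eliminated only by dividing by `k₂`, so it stays a variable. The two
        -- sides then differ by a multiple of the relation `B-suc l`; the multiplier is x (1 + t)²,
        -- written out.
        ≈⟨ solve 5 (λ t k₀ a₀ b₀ b₁ →
            let o  = con ℤ.1ℤ
                x  = t :* t
                a₁ = a₀ :+ x :* a₀ :+ (x :* b₀ :+ x :* b₀)
                k₁ = o :+ k₀ ; k₂ = o :+ k₁ ; k₃ = o :+ k₂
                t² = t :* (t :* o)
            in k₃ :* t :* (a₁ :+ x :* a₁ :+ (x :* b₁ :+ x :* b₁)) :- x :* (k₂ :* (a₁ :+ a₁ :+ (b₁ :+ x :* b₁)))
               := ((o :+ (o :+ con ℤ.0ℤ)) :* ((k₂ :* (o :+ t²) :- t) :* (t :* (a₁ :- t :* b₁)))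
                     :- k₁ :* (((o :- t²) :* ((o :- t²) :* o)) :* (t :* (a₀ :- t :* b₀))))
                  :+ (t :* x :+ t :* x :+ (x :+ x :* x)) :* (k₂ :* b₁ :- k₁ :* (a₀ :+ a₀ :+ (b₀ :+ x :* b₀))))
          refl t ⟨ l ⟩ (A l) (B l) (B (suc l)) ⟩
      rhs a₁ + (t * x + t * x + (x + x * x)) * (k₂ * B (suc l) - k₁ * (A l + A l + (B l + x * B l)))
        ≈⟨ +-congˡ (trans (*-congˡ (trans (+-congʳ (B-suc l)) (-‿inverseʳ _))) (zeroʳ _)) ⟩
      rhs a₁ + 0#
        ≈⟨ +-identityʳ _ ⟩
      rhs a₁
        ≈⟨ +-cong (*-congˡ (*-cong (+-congʳ (·-≈ (suc (suc l)) _)) (*-congˡ (+-congʳ (A-suc l))))) refl ⟨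
      ⟨ 2 ⟩ * ((suc (suc l) · (1# + t ^ 2) - t) * (t * V (suc l) (suc l))) - k₁ * ((1# - t ^ 2) ^ 2 * (t * V l l))
        ≈⟨ +-cong (·-≈ 2 _) (-‿cong (·-≈ (suc l) _)) ⟨
      2 · ((suc (suc l) · (1# + t ^ 2) - t) * (t * V (suc l) (suc l))) - suc l · ((1# - t ^ 2) ^ 2 * (t * V l l)) ∎
      where
      k₁ = ⟨ suc l ⟩
      k₂ = ⟨ suc (suc l) ⟩
      k₃ = ⟨ suc (suc (suc l)) ⟩
      a₁ = A l + x * A l + (x * B l + x * B l)

      lhs rhs : Carrier → Carrier
      lhs a = k₃ * t * (a + x * a + (x * B (suc l) + x * B (suc l))) - x * (k₂ * (a + a + (B (suc l) + x * B (suc l))))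
      rhs a = ⟨ 2 ⟩ * ((k₂ * (1# + t ^ 2) - t) * (t * (a - t * B (suc l)))) - k₁ * ((1# - t ^ 2) ^ 2 * (t * V l l))

    -- Comparison with the binomial formula.

    closed-form : ℕ → Carrier
    closed-form n = ∑[ k ∈ [1⋯ n ] ] ((- 1#) ^ (n ∸ k) * s n k · t ^ k)

    module _ (p : ℕ) where

      lo hi : ℕ
      lo = ⌊ p /2⌋
      hi = ⌈ p /2⌉

      term : ℕ → Carrier
      term i = (σ p * σ i) * ((lo C ⌊ i /2⌋) ℕ.* (hi C ⌈ i /2⌉)) · t ^ suc i

      t^ : ∀ j → t ^ (j ℕ.* 2) ≈ x ^ j
      t^ zero    = refl
      t^ (suc j) = trans (sym (*-assoc t t _)) (*-congˡ (t^ j))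

      -- The terms i = 2j and i = 2j + 1 are paired: the floors of i/2 are both j, the ceilings are
      -- j and j + 1, so the two halves carry the coefficients of G₀ and G₁ with opposite signs.
      ∑-terms : ∀ {N} → lo < N → Σ< (N ℕ.* 2) term ≈ σ p * (t * (G 1 lo hi - t * G 2 lo hi))
      ∑-terms {N} lo<N = begin
        Σ< (N ℕ.* 2) term
          ≈⟨ Σ<-pairs N term ⟩
        Σ< N (λ j → term (j ℕ.* 2) + term (suc (j ℕ.* 2)))
          ≈⟨ Σ<-cong N (λ j _ → pair j) ⟩
        Σ< N (λ j → (σ p * t) * coeff-G 0 lo hi j · x ^ j + (- (σ p * x)) * coeff-G 1 lo hi j · x ^ j)
          ≈⟨ Σ<-distrib-+ N _ _ ⟩
        Σ< N (λ j → (σ p * t) * coeff-G 0 lo hi j · x ^ j) + Σ< N (λ j → (- (σ p * x)) * coeff-G 1 lo hi j · x ^ j)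
          ≈⟨ +-cong (Σ<-distribˡ (σ p * t) N _) (Σ<-distribˡ (- (σ p * x)) N _) ⟨
        (σ p * t) * Σ< N (λ j → coeff-G 0 lo hi j · x ^ j) + (- (σ p * x)) * Σ< N (λ j → coeff-G 1 lo hi j · x ^ j)
          ≈⟨ +-cong (*-congˡ (G-explicit 0 lo hi lo<N)) (*-congˡ (G-explicit 1 lo hi lo<N)) ⟨
        (σ p * t) * G 1 lo hi + (- (σ p * x)) * G 2 lo hi
          ≈⟨ solve 4 (λ s t g₁ g₂ → s :* t :* g₁ :+ (:- (s :* (t :* t))) :* g₂ := s :* (t :* (g₁ :- t :* g₂)))
               refl (σ p) t (G 1 lo hi) (G 2 lo hi) ⟩
        σ p * (t * (G 1 lo hi - t * G 2 lo hi)) ∎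
        where
        pair : ∀ j → term (j ℕ.* 2) + term (suc (j ℕ.* 2))
                   ≈ (σ p * t) * coeff-G 0 lo hi j · x ^ j + (- (σ p * x)) * coeff-G 1 lo hi j · x ^ j
        pair j = +-cong
          (begin
            (σ p * σ (j ℕ.* 2)) * ((lo C ⌊ j ℕ.* 2 /2⌋) ℕ.* (hi C ⌈ j ℕ.* 2 /2⌉)) · (t * t ^ (j ℕ.* 2))
              ≈⟨ *-cong (trans (*-congˡ (σ-even j)) (*-identityʳ (σ p)))
                   (trans (×-congˡ (≡.cong₂ (λ y z → (lo C y) ℕ.* (hi C z)) (⌊m*2/2⌋≡m j) (⌊1+m*2/2⌋≡m j)))
                     (trans (×-congʳ (coeff-G 0 lo hi j) (*-congˡ (t^ j)))
                       (sym (×-comm-* (coeff-G 0 lo hi j) t (x ^ j))))) ⟩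
            σ p * (t * coeff-G 0 lo hi j · x ^ j)
              ≈⟨ *-assoc _ _ _ ⟨
            (σ p * t) * coeff-G 0 lo hi j · x ^ j ∎)
          (begin
            (σ p * σ (suc (j ℕ.* 2)))
              * ((lo C ⌊ suc (j ℕ.* 2) /2⌋) ℕ.* (hi C suc ⌊ j ℕ.* 2 /2⌋)) · (t * (t * t ^ (j ℕ.* 2)))
              ≈⟨ *-cong (*-congˡ (σ-odd j))
                   (trans (×-congˡ (≡.cong₂ (λ y z → (lo C y) ℕ.* (hi C suc z)) (⌊1+m*2/2⌋≡m j) (⌊m*2/2⌋≡m j)))
                     (trans (×-congʳ (coeff-G 1 lo hi j) (trans (sym (*-assoc t t _)) (*-congˡ (t^ j))))
                       (sym (×-comm-* (coeff-G 1 lo hi j) x (x ^ j))))) ⟩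
            (σ p * (- 1#)) * (x * coeff-G 1 lo hi j · x ^ j)
              ≈⟨ solve 3 (λ s x y → (s :* (:- con ℤ.1ℤ)) :* (x :* y) := (:- (s :* x)) :* y) refl (σ p) x _ ⟩
            (- (σ p * x)) * coeff-G 1 lo hi j · x ^ j ∎)

      closed-form-terms : closed-form (suc p) ≈ Σ< (suc p) term
      closed-form-terms = trans
        (reflexive (∑-applyUpTo suc (suc p) (λ k → (- 1#) ^ (suc p ∸ k) * s (suc p) k · t ^ k)))
        (Σ<-cong (suc p) λ i i≤p → *-congʳ {x = s (suc p) (suc i) · t ^ suc i} (sym (begin
          σ p * σ i               ≡⟨ ≡.cong (λ k → σ k * σ i) (ℕ.m∸n+n≡m (s≤s⁻¹ i≤p)) ⟨
          σ (p ∸ i ℕ.+ i) * σ i   ≈⟨ σ-+-cancel (p ∸ i) i ⟩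
          σ (p ∸ i)               ∎)))

    F≈closed-form : ∀ p → F (suc p) 0 ≈ closed-form (suc p)
    F≈closed-form p with parity p
    ... | even m = begin
      F (suc (m ℕ.* 2)) 0
        ≈⟨ F-odd m ⟩
      t * V m m
        ≡⟨ ≡.cong₂ (λ a b → t * V a b) a≡m b≡m ⟨
      t * V (lo (m ℕ.* 2)) (hi (m ℕ.* 2))
        ≈⟨ trans (*-congʳ (σ-even m)) (*-identityˡ _) ⟨
      σ (m ℕ.* 2) * (t * V (lo (m ℕ.* 2)) (hi (m ℕ.* 2)))
        ≈⟨ ∑-terms (m ℕ.* 2) (s≤s (ℕ.≤-reflexive a≡m)) ⟨
      Σ< (suc m ℕ.* 2) (term (m ℕ.* 2))
        ≈⟨ Σ<-last (suc (m ℕ.* 2)) (term (m ℕ.* 2)) ⟩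
      Σ< (suc (m ℕ.* 2)) (term (m ℕ.* 2)) + term (m ℕ.* 2) (suc (m ℕ.* 2))
        ≈⟨ +-cong (closed-form-terms (m ℕ.* 2)) (sym last≈0) ⟨
      closed-form (suc (m ℕ.* 2)) + 0#
        ≈⟨ +-identityʳ _ ⟩
      closed-form (suc (m ℕ.* 2)) ∎
      where
      a≡m = ⌊m*2/2⌋≡m m
      b≡m = ⌊1+m*2/2⌋≡m m

      -- Pairing needs an even number of terms but here there are 2m + 1; the term added contains
      -- C(m, m + 1) = 0.
      last≈0 : term (m ℕ.* 2) (suc (m ℕ.* 2)) ≈ 0#
      last≈0 = trans (*-congˡ (×-congˡ (≡.trans
        (≡.cong ((lo (m ℕ.* 2) C ⌊ suc (m ℕ.* 2) /2⌋) ℕ.*_) (k>n⇒nCk≡0 (s≤s (ℕ.≤-reflexive (≡.trans b≡m (≡.sym a≡m))))))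
        (ℕ.*-zeroʳ (lo (m ℕ.* 2) C ⌊ suc (m ℕ.* 2) /2⌋))))) (zeroʳ _)
    ... | odd m = begin
      F (suc m ℕ.* 2) 0
        ≈⟨ trans (F-even m) (*-congˡ (F-odd m)) ⟩
      (t - 1#) * (t * V m m)
        -- By Pascal's rule and the symmetry, `V m (suc m)` is `(1# - t) * V m m`; the factor
        -- `t - 1#` thus turns into the sign of the odd exponent and a step from (m, m) to (m, m +
        -- 1).
        ≈⟨ solve 3 (λ t g₁ g₂ → (t :- con ℤ.1ℤ) :* (t :* (g₁ :- t :* g₂))
                              := (:- con ℤ.1ℤ) :* (t :* ((g₁ :+ (t :* t) :* g₂) :- t :* (g₂ :+ g₁))))
             refl t (A m) (B m) ⟩
      (- 1#) * (t * ((A m + x * B m) - t * (B m + A m)))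
        ≈⟨ *-congˡ (*-congˡ (+-cong (trans (G-sucʳ 0 m m) (+-congˡ (G₋₁-sym m m))) (-‿cong (*-congˡ (G-sucʳ 1 m m))))) ⟨
      (- 1#) * (t * V m (suc m))
        ≈⟨ *-cong (σ-odd m) (reflexive (≡.cong₂ (λ a b → t * V a b) a≡m b≡1+m)) ⟨
      σ (suc (m ℕ.* 2)) * (t * V (lo (suc (m ℕ.* 2))) (hi (suc (m ℕ.* 2))))
        ≈⟨ ∑-terms (suc (m ℕ.* 2)) (s≤s (ℕ.≤-reflexive a≡m)) ⟨
      Σ< (suc m ℕ.* 2) (term (suc (m ℕ.* 2)))
        ≈⟨ closed-form-terms (suc (m ℕ.* 2)) ⟨
      closed-form (suc m ℕ.* 2) ∎
      where
      a≡m   = ⌊1+m*2/2⌋≡m m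
      b≡1+m = ≡.cong suc (⌊m*2/2⌋≡m m)

    -- The recurrences in the form of the theorem.

    module _ {J : ℕ → Carrier} (J≈F : ∀ n → J n ≈ F n 0) where

      J-odd : ∀ m → J (suc (m ℕ.* 2)) ≈ t * V m m
      J-odd m = trans (J≈F (suc (m ℕ.* 2))) (F-odd m)

      -- `k` stands for 2n. As a separate argument it can be taken as `suc m ℕ.* 2`, on which the
      -- truncated subtractions compute, and be transported to `2 ℕ.* suc m` at the end.
      Recurrences : ℕ → ℕ → Set ℓ
      Recurrences n k = (J k ≈ (t - 1#) * J (k ∸ 1))
        × ((n ℕ.+ 1) · J (k ℕ.+ 1)
             ≈ 2 · ((n · (1# + t ^ 2) - t) * J (k ∸ 1)) - (n ∸ 1) · ((1# - t ^ 2) ^ 2 * J (k ∸ 3)))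

      recurrences : ∀ m → Recurrences (suc m) (2 ℕ.* suc m)
      recurrences m = ≡.subst (Recurrences (suc m)) (ℕ.*-comm (suc m) 2) (first , second m)
        where
        first : J (suc m ℕ.* 2) ≈ (t - 1#) * J (suc (m ℕ.* 2))
        first = trans (J≈F (suc m ℕ.* 2)) (trans (F-even m) (*-congˡ (sym (J≈F (suc (m ℕ.* 2))))))

        J-next : ∀ m → (suc m ℕ.+ 1) · J (suc m ℕ.* 2 ℕ.+ 1) ≈ suc (suc m) · (t * V (suc m) (suc m))
        J-next m = begin
          (suc m ℕ.+ 1) · J (suc m ℕ.* 2 ℕ.+ 1)
            ≡⟨ ≡.cong₂ (λ i j → i · J j) (ℕ.+-comm (suc m) 1) (ℕ.+-comm (suc m ℕ.* 2) 1) ⟩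
          suc (suc m) · J (suc (suc m ℕ.* 2))
            ≈⟨ ×-congʳ (suc (suc m)) (J-odd (suc m)) ⟩
          suc (suc m) · (t * V (suc m) (suc m)) ∎

        second : ∀ m → (suc m ℕ.+ 1) · J (suc m ℕ.* 2 ℕ.+ 1)
          ≈ 2 · ((suc m · (1# + t ^ 2) - t) * J (suc (m ℕ.* 2))) - m · ((1# - t ^ 2) ^ 2 * J (suc m ℕ.* 2 ∸ 3))
        second zero    = begin
          2 · J 3
            ≈⟨ J-next 0 ⟩
          2 · (t * V 1 1)
            ≈⟨ V-recurrence-1 ⟩
          2 · ((1 · (1# + t ^ 2) - t) * (t * V 0 0))
            ≈⟨ ×-congʳ 2 (*-congˡ (J-odd 0)) ⟨
          2 · ((1 · (1# + t ^ 2) - t) * J 1)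
            -- For n = 1 the index 2n - 3 truncates to 0, but the 0-fold multiple of `J 0` is `0#`
            -- by definition.
            ≈⟨ solve 1 (λ y → y := y :- con ℤ.0ℤ) refl _ ⟩
          2 · ((1 · (1# + t ^ 2) - t) * J 1) - 0# ∎
        second (suc l) = begin
          (suc (suc l) ℕ.+ 1) · J (suc (suc l) ℕ.* 2 ℕ.+ 1)
            ≈⟨ J-next (suc l) ⟩
          suc (suc (suc l)) · (t * V (suc (suc l)) (suc (suc l)))
            ≈⟨ V-recurrence l ⟩
          2 · ((suc (suc l) · (1# + t ^ 2) - t) * (t * V (suc l) (suc l))) - suc l · ((1# - t ^ 2) ^ 2 * (t * V l l))
            ≈⟨ +-cong (×-congʳ 2 (*-congˡ (J-odd (suc l)))) (-‿cong (×-congʳ (suc l) (*-congˡ (J-odd l)))) ⟨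
          2 · ((suc (suc l) · (1# + t ^ 2) - t) * J (suc (suc l ℕ.* 2)))
            - suc l · ((1# - t ^ 2) ^ 2 * J (suc (l ℕ.* 2))) ∎

-- Specialisation of ℤ[q][t] at q = -1, and the theorem.

open import Defs

module ℤ[t]-Ring = PolynomialRing ℤ.+-*-commutativeRing

ℤ[t]-ring : CommutativeRing _ _
ℤ[t]-ring = ℤ[t]-Ring.commutativeRing

const : ℤ → ℤ[t]
const = ℤ[t]-Poly.const

const-homomorphism : ℤ.+-*-rawRing -Raw-AlmostCommutative⟶ fromCommutativeRing ℤ[t]-ring
const-homomorphism = record
  { ⟦_⟧    = const
  ; +-homo = λ _ _ → refl
  ; *-homo = λ a b → ℤ[t]-Poly.mk≈ λ { zero → ≡.sym (ℤ.+-identityʳ (a ℤ.* b)) ; (suc _) → ≡.refl }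
  ; -‿homo = λ _ → refl
  ; 0-homo = ℤ[t]-Ring.0∷0≈0
  ; 1-homo = refl
  }
  where open CommutativeRing ℤ[t]-ring using (refl)

module Specialisation (q₀ : ℤ) where

  open ℤ[q]-Poly using (evaluate)
  private
    module P = ℤ[q]-Poly
    module PP = ℤ[q][t]-Poly

  open ≡.≡-Reasoning

  evaluate-const : ∀ a → evaluate q₀ (P.const a) ≡ a
  evaluate-const a = ≡.trans (≡.cong (ℤ._+_ a) (ℤ.*-zeroʳ q₀)) (ℤ.+-identityʳ a)

  evaluate-+ : ∀ p q → evaluate q₀ (p P.+ q) ≡ evaluate q₀ p ℤ.+ evaluate q₀ q
  evaluate-+ []      q       = ≡.sym (ℤ.+-identityˡ _)
  evaluate-+ (a ∷ p) []      = ≡.sym (ℤ.+-identityʳ _)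
  evaluate-+ (a ∷ p) (b ∷ q) = ≡.trans
    (≡.cong (λ z → a ℤ.+ b ℤ.+ q₀ ℤ.* z) (evaluate-+ p q))
    (solve 5 (λ a b x p q → a :+ b :+ x :* (p :+ q) := (a :+ x :* p) :+ (b :+ x :* q)) ≡.refl a b q₀ _ _)
    where open +-*-Solver

  evaluate-∙ : ∀ a p → evaluate q₀ (List.map (a ℤ.*_) p) ≡ a ℤ.* evaluate q₀ p
  evaluate-∙ a []      = ≡.sym (ℤ.*-zeroʳ a)
  evaluate-∙ a (b ∷ p) = ≡.trans
    (≡.cong (λ z → a ℤ.* b ℤ.+ q₀ ℤ.* z) (evaluate-∙ a p))
    (solve 4 (λ a b x p → a :* b :+ x :* (a :* p) := a :* (b :+ x :* p)) ≡.refl a b q₀ _)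
    where open +-*-Solver

  evaluate-* : ∀ p q → evaluate q₀ (p P.* q) ≡ evaluate q₀ p ℤ.* evaluate q₀ q
  evaluate-* []      q = ≡.refl
  evaluate-* (a ∷ p) q = begin
    evaluate q₀ (List.map (a ℤ.*_) q P.+ (ℤ.0ℤ ∷ p P.* q))
      ≡⟨ evaluate-+ (List.map (a ℤ.*_) q) _ ⟩
    evaluate q₀ (List.map (a ℤ.*_) q) ℤ.+ (ℤ.0ℤ ℤ.+ q₀ ℤ.* evaluate q₀ (p P.* q))
      ≡⟨ ≡.cong₂ (λ y z → y ℤ.+ (ℤ.0ℤ ℤ.+ q₀ ℤ.* z)) (evaluate-∙ a q) (evaluate-* p q) ⟩
    a ℤ.* evaluate q₀ q ℤ.+ (ℤ.0ℤ ℤ.+ q₀ ℤ.* (evaluate q₀ p ℤ.* evaluate q₀ q))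
      ≡⟨ solve 4 (λ a x p q → a :* q :+ (con ℤ.0ℤ :+ x :* (p :* q)) := (a :+ x :* p) :* q)
           ≡.refl a q₀ _ (evaluate q₀ q) ⟩
    (a ℤ.+ q₀ ℤ.* evaluate q₀ p) ℤ.* evaluate q₀ q ∎
    where open +-*-Solver

  specialise-+ : ∀ p q → specialise q₀ (p PP.+ q) ≡ specialise q₀ p + specialise q₀ q
  specialise-+ []      q       = ≡.refl
  specialise-+ (a ∷ p) []      = ≡.refl
  specialise-+ (a ∷ p) (b ∷ q) = ≡.cong₂ _∷_ (evaluate-+ a b) (specialise-+ p q)

  specialise-∙ : ∀ a p → specialise q₀ (List.map (a P.*_) p) ≡ List.map (evaluate q₀ a ℤ.*_) (specialise q₀ p)
  specialise-∙ a []      = ≡.refl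
  specialise-∙ a (b ∷ p) = ≡.cong₂ _∷_ (evaluate-* a b) (specialise-∙ a p)

  specialise-* : ∀ p q → specialise q₀ (p PP.* q) ≡ specialise q₀ p * specialise q₀ q
  specialise-* []      q = ≡.refl
  specialise-* (a ∷ p) q = ≡.trans
    (specialise-+ (List.map (a P.*_) q) _)
    (≡.cong₂ (λ y z → y + (ℤ.0ℤ ∷ z)) (specialise-∙ a q) (specialise-* p q))

  specialise-∑ : ∀ {a} {A : Set a} (xs : List A) f → specialise q₀ (ℤ[q][t].∑ xs f) ≡ ∑ xs (specialise q₀ ∘ f)
  specialise-∑ []       f = ≡.refl
  specialise-∑ (x ∷ xs) f = ≡.trans (specialise-+ (f x) _) (≡.cong (specialise q₀ (f x) +_) (specialise-∑ xs f))

  specialise-T : specialise q₀ PP.X ≡ t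
  specialise-T = ≡.cong (λ z → ℤ.0ℤ ∷ z ∷ []) (evaluate-const ℤ.1ℤ)

  specialise-T^ : ∀ k → specialise q₀ (PP.X ℤ[q][t].^ k) ≡ t ^ k
  specialise-T^ zero    = ≡.cong (_∷ []) (evaluate-const ℤ.1ℤ)
  specialise-T^ (suc k) = ≡.trans (specialise-* PP.X (PP.X ℤ[q][t].^ k)) (≡.cong₂ _*_ specialise-T (specialise-T^ k))

open CommutativeRing ℤ[t]-ring using (refl; trans; reflexive; *-cong; *-congˡ)

I₋₁≈∑ : ∀ n → I₋₁ n ≈ ∑[ σ ∈ Av321 n ] (- 1#) ^ inv σ * t ^ lrm σ
I₋₁≈∑ n = trans
  (reflexive (specialise-∑ (Av321 n) _))
  (Sums.∑-cong ℤ[t]-ring (Av321 n) λ σ → trans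
    (reflexive (specialise-* (ℤ[q][t]-Poly.const (ℤ[q]-Poly.X ℤ[q].^ inv σ)) (ℤ[q][t]-Poly.X ℤ[q][t].^ lrm σ)))
    (*-cong (specialise-q^ (inv σ)) (reflexive (specialise-T^ (lrm σ)))))
  where
  open Specialisation -1ℤ

  specialise-q^ : ∀ k → const (ℤ[q]-Poly.evaluate -1ℤ (ℤ[q]-Poly.X ℤ[q].^ k)) ≈ (- 1#) ^ k
  specialise-q^ zero    = refl
  specialise-q^ (suc k) = trans
    (reflexive (≡.cong const (evaluate-* ℤ[q]-Poly.X (ℤ[q]-Poly.X ℤ[q].^ k))))
    (trans (_-Raw-AlmostCommutative⟶_.*-homo const-homomorphism -1ℤ _) (*-congˡ {x = - 1#} (specialise-q^ k)))

open ClosedForm ℤ[t]-ring const-homomorphism using (F≈closed-form; recurrences)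
open Enumeration ℤ[t]-ring (- 1#) t using (∑-Av321)

theorem3p4 : (∀ (n : ℕ) → n ≥ 1 →
    (I₋₁ n ≈ ∑[ σ ∈ Av321 n ] (- 1#) ^ inv σ * t ^ lrm σ)
    × ((∑[ σ ∈ Av321 n ] (- 1#) ^ inv σ * t ^ lrm σ)
    ≈ ∑[ k ∈ [1⋯ n ] ] (- 1#) ^ (n ∸ k) * s n k · t ^ k))
    × (∀ (n : ℕ) → n ≥ 1 →
    (I₋₁ (2 ℕ.* n) ≈ (t - 1#) * I₋₁ (2 ℕ.* n ∸ 1))
    × ((n ℕ.+ 1) · I₋₁ (2 ℕ.* n ℕ.+ 1)
    ≈ 2 · ((n · (1# + t ^ 2) - t) * I₋₁ (2 ℕ.* n ∸ 1))
    - (n ∸ 1) · ((1# - t ^ 2) ^ 2 * I₋₁ (2 ℕ.* n ∸ 3))))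
theorem3p4 =
    (λ { (suc p) _ → I₋₁≈∑ (suc p) , trans (∑-Av321 (suc p)) (F≈closed-form t p) })
  , (λ { (suc m) _ → recurrences t (λ n → trans (I₋₁≈∑ n) (∑-Av321 n)) m })
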